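{- Let $n\geq 1$ and $k\geq 2$ be integers, and let $r$ be an integer with $1\le r\le$ the number of length-$n$ unbordered words over $\Sigma_k$. The unbordered word $w\in\Sigma_k^n$ with rank $r$ (i.e., the $r$-th word in the lexicographic listing of all length-$n$ unbordered words over $\Sigma_k$) can be computed from $r,n,k$ in $O(n^4k\log k)$ time using $O(n)$ space, under the unit-cost RAM model.
   Context: $\Sigma_k=\{1,2,\ldots,k\}$ with $1<2<\cdots<k$, and $\Sigma_k^n$ is the set of length-$n$ words over $\Sigma_k$. Lexicographic order: for $x=x_1\cdots x_m$ and $y=y_1\cdots y_n$, $x<y$ if $x$ is a proper prefix of $y$, or if $x_i<y_i$ for the smallest $i$ with $x_i\neq y_i$. A border of a word $w$ is a word that is both a non-empty proper prefix and a non-empty proper suffix of $w$; $w$ is unbordered if it has no border. Ranks start at $1$. Unit-cost RAM model: integer variables use constant space and integer arithmetic operations take constant time. -}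

module Defs where

open import Data.Nat using (ℕ; zero; suc; _+_; _≤_; _<_; s≤s; z≤n)
open import Data.Nat.Properties using (m<m+n) renaming (_≟_ to _≟ℕ_)
open import Data.Integer using (ℤ; +_; 0ℤ) renaming (_+_ to _+ℤ_; _-_ to _-ℤ_; _*_ to _*ℤ_; _<_ to _<ℤ_; NonZero to NonZeroℤ)
open import Data.Integer.DivMod using () renaming (_/_ to _/ℤ_)
open import Data.Fin using (Fin; toℕ; fromℕ<) renaming (_<_ to _<ᶠ_)
open import Data.Fin.Properties using (toℕ-fromℕ<; any?) renaming (_≟_ to _≟ᶠ_)
open import Data.List using (List; []; _∷_; _++_; length; lookup; filter; head; drop; take; allFin; cartesianProductWith; deduplicate)
open import Data.List.Properties using (≡-dec; length-++)
open import Data.List.Membership.Propositional using (_∈_)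
open import Data.List.Membership.Propositional.Properties using (∈-filter⁺; ∈-filter⁻; ∈-allFin; ∈-cartesianProductWith⁺; ∈-cartesianProductWith⁻)
open import Data.List.Relation.Binary.Lex.Strict using (Lex-<; this; next)
open import Data.List.Relation.Unary.All as All using (All; []; _∷_)
import Data.List.Relation.Unary.All.Properties as AllP
open import Data.List.Relation.Unary.AllPairs as AllPairs using (AllPairs; []; _∷_)
import Data.List.Relation.Unary.AllPairs.Properties as AllPairsP
open import Data.List.Relation.Unary.Any using (here)
open import Data.Maybe using (Maybe; just)
open import Data.Product using (∃-syntax; Σ-syntax; _×_; _,_)
open import Data.Sum using (_⊎_; inj₁; inj₂)
open import Data.Empty using (⊥-elim)
open import Function using (id)
open import Function.Bundles using (_⇔_; mk⇔)
open import Relation.Nullary using (¬_; Dec; yes; no)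
open import Relation.Nullary.Decidable using (map′; _×-dec_; _⊎-dec_; ¬?)
open import Relation.Binary.PropositionalEquality using (_≡_; _≢_; refl; sym; trans; cong; subst)

-- The letter of Σ_k = {1,…,k} represented by a : Fin k is suc (toℕ a).
Word : ℕ → Set
Word k = List (Fin k)

infix 4 _<lex_
_<lex_ : ∀ {k} → Word k → Word k → Set
_<lex_ = Lex-< _≡_ _<ᶠ_

ProperPrefix ProperSuffix : ∀ {k} → Word k → Word k → Set
ProperPrefix u w = ∃[ v ] (v ≢ [] × u ++ v ≡ w)
ProperSuffix u w = ∃[ v ] (v ≢ [] × v ++ u ≡ w)

Border : ∀ {k} → Word k → Word k → Set
Border u w = u ≢ [] × ProperPrefix u w × ProperSuffix u w

Unbordered : ∀ {k} → Word k → Set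
Unbordered w = ¬ (∃[ u ] Border u w)

private
  nonEmpty? : ∀ {k} (w : Word k) → Dec (w ≢ [])
  nonEmpty? []      = no (λ ne → ne refl)
  nonEmpty? (_ ∷ _) = yes (λ ())

  properPrefix? : ∀ {k} (u w : Word k) → Dec (ProperPrefix u w)
  properPrefix? [] w = map′ (λ ne → w , ne , refl) (λ { (_ , ne , refl) → ne }) (nonEmpty? w)
  properPrefix? (a ∷ u) [] = no (λ { (_ , _ , ()) })
  properPrefix? (a ∷ u) (b ∷ w) =
    map′ (λ { (refl , v , ne , refl) → v , ne , refl })
         (λ { (v , ne , refl) → refl , v , ne , refl })
         (a ≟ᶠ b ×-dec properPrefix? u w)

  properSuffix? : ∀ {k} (u w : Word k) → Dec (ProperSuffix u w)
  properSuffix? u [] = no (λ { ([] , ne , _) → ne refl })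
  properSuffix? u (b ∷ w) = map′ to from (≡-dec _≟ᶠ_ u w ⊎-dec properSuffix? u w)
    where
    to : u ≡ w ⊎ ProperSuffix u w → ProperSuffix u (b ∷ w)
    to (inj₁ refl)           = b ∷ [] , (λ ()) , refl
    to (inj₂ (v , _ , refl)) = b ∷ v , (λ ()) , refl
    from : ProperSuffix u (b ∷ w) → u ≡ w ⊎ ProperSuffix u w
    from ([] , ne , _)          = ⊥-elim (ne refl)
    from (_ ∷ [] , _ , refl)    = inj₁ refl
    from (_ ∷ c ∷ v , _ , refl) = inj₂ (c ∷ v , (λ ()) , refl)

  border? : ∀ {k} (u w : Word k) → Dec (Border u w)
  border? u w = nonEmpty? u ×-dec properPrefix? u w ×-dec properSuffix? u w

  take-length-++ : ∀ {k} (u v : Word k) → take (length u) (u ++ v) ≡ u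
  take-length-++ []      v = refl
  take-length-++ (a ∷ u) v = cong (a ∷_) (take-length-++ u v)

  length-< : ∀ {k} (u v : Word k) → v ≢ [] → length u < length (u ++ v)
  length-< u []      ne = ⊥-elim (ne refl)
  length-< u (b ∷ v) _  = subst (length u <_) (sym (length-++ u)) (m<m+n (length u) (s≤s z≤n))

  bordered? : ∀ {k} (w : Word k) → Dec (∃[ u ] Border u w)
  bordered? w = map′ (λ { (i , b) → take (toℕ i) w , b }) from
                     (any? {n = length w} (λ i → border? (take (toℕ i) w) w))
    where
    from : ∃[ u ] Border u w → ∃[ i ] Border (take (toℕ {length w} i) w) w
    from (u , b@(_ , (v , ne , refl) , _)) =
      fromℕ< u< , subst (λ x → Border x (u ++ v)) (sym eq) b
      where
      u< = length-< u v ne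
      eq : take (toℕ (fromℕ< u<)) (u ++ v) ≡ u
      eq = trans (cong (λ j → take j (u ++ v)) (toℕ-fromℕ< u<)) (take-length-++ u v)

unbordered? : ∀ {k} (w : Word k) → Dec (Unbordered w)
unbordered? w = ¬? (bordered? w)

words : ∀ k → ℕ → List (Word k)
words k zero    = [] ∷ []
words k (suc n) = cartesianProductWith _∷_ (allFin k) (words k n)

unborderedWords : ∀ k → ℕ → List (Word k)
unborderedWords k n = filter unbordered? (words k n)

record IsLexListing {k} (P : Word k → Set) (L : List (Word k)) : Set where
  field
    increasing : AllPairs _<lex_ L
    complete   : ∀ w → w ∈ L ⇔ P w

private
  words-increasing : ∀ k n → AllPairs _<lex_ (words k n)
  words-increasing k zero    = [] ∷ []
  words-increasing k (suc n) = go (allFin k) (AllPairsP.tabulate⁺-< id)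
    where
    W = words k n
    below : ∀ {a} (x : Word k) as → All (a <ᶠ_) as → All ((a ∷ x) <lex_) (cartesianProductWith _∷_ as W)
    below x []       []       = []
    below x (b ∷ as) (p ∷ ps) = AllP.++⁺ (AllP.map⁺ (All.universal (λ _ → this p) W)) (below x as ps)
    go : ∀ as → AllPairs _<ᶠ_ as → AllPairs _<lex_ (cartesianProductWith _∷_ as W)
    go []       []       = []
    go (a ∷ as) (p ∷ ps) = AllPairsP.++⁺
      (AllPairsP.map⁺ (AllPairs.map (next refl) (words-increasing k n)))
      (go as ps)
      (AllP.map⁺ (All.universal (λ x → below x as p) W))

  ∈-words⁺ : ∀ {k} (w : Word k) → w ∈ words k (length w)
  ∈-words⁺ []      = here refl
  ∈-words⁺ (a ∷ w) = ∈-cartesianProductWith⁺ _∷_ (∈-allFin a) (∈-words⁺ w)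

  ∈-words⁻ : ∀ {k} n {w : Word k} → w ∈ words k n → length w ≡ n
  ∈-words⁻ zero (here refl) = refl
  ∈-words⁻ {k} (suc n) w∈ with ∈-cartesianProductWith⁻ _∷_ (allFin k) (words k n) w∈
  ... | _ , _ , _ , w′∈ , refl = cong suc (∈-words⁻ n w′∈)

unborderedWords-isLexListing : ∀ k n → IsLexListing (λ w → length w ≡ n × Unbordered w) (unborderedWords k n)
unborderedWords-isLexListing k n = record
  { increasing = AllPairsP.filter⁺ unbordered? (words-increasing k n)
  ; complete   = λ w → mk⇔
      (λ w∈ → let (w∈′ , ub) = ∈-filter⁻ unbordered? {xs = words k n} w∈ in ∈-words⁻ n w∈′ , ub)
      (λ { (refl , ub) → ∈-filter⁺ unbordered? (∈-words⁺ w) ub })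
  }

HasRank : ∀ {k} → ℕ → Word k → ℕ → Set
HasRank {k} n w r =
  Σ[ i ∈ Fin (length (unborderedWords k n)) ] (suc (toℕ i) ≡ r × lookup (unborderedWords k n) i ≡ w)

-- Unit-cost RAM: a fixed finite program acting on registers R[0], R[1], …,
-- each holding an arbitrary integer; every executed instruction costs one.

Addr Label : Set
Addr  = ℕ
Label = ℕ

data Instr : Set where
  const           : Addr → ℤ → Instr
  move            : Addr → Addr → Instr
  add sub mul div : Addr → Addr → Addr → Instr
  load store      : Addr → Addr → Instr
  jump            : Label → Instr
  jzero jneg      : Addr → Label → Instr
  halt            : Instr

Program : Set
Program = List Instr

Memory : Set
Memory = Addr → ℤ

infix 9 _[_≔_]
_[_≔_] : Memory → Addr → ℤ → Memory
(m [ a ≔ x ]) b with b ≟ℕ a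
... | yes _ = x
... | no  _ = m b

Config : Set
Config = Label × Memory

fetch : Program → Label → Maybe Instr
fetch P pc = head (drop pc P)

-- Exec ι c as c′: executing ι takes c to c′ and accesses the registers in as.
-- A negative indirect address or a zero divisor has no rule: the machine is
-- stuck and never halts.  Division is Euclidean (remainder ≥ 0).
data Exec : Instr → Config → List Addr → Config → Set where
  const  : ∀ {pc m a x} → Exec (const a x) (pc , m) (a ∷ []) (suc pc , m [ a ≔ x ])
  move   : ∀ {pc m a b} → Exec (move a b) (pc , m) (a ∷ b ∷ []) (suc pc , m [ a ≔ m b ])
  add    : ∀ {pc m a b c} → Exec (add a b c) (pc , m) (a ∷ b ∷ c ∷ []) (suc pc , m [ a ≔ m b +ℤ m c ])
  sub    : ∀ {pc m a b c} → Exec (sub a b c) (pc , m) (a ∷ b ∷ c ∷ []) (suc pc , m [ a ≔ m b -ℤ m c ])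
  mul    : ∀ {pc m a b c} → Exec (mul a b c) (pc , m) (a ∷ b ∷ c ∷ []) (suc pc , m [ a ≔ m b *ℤ m c ])
  div    : ∀ {pc m a b c} .{{_ : NonZeroℤ (m c)}} → Exec (div a b c) (pc , m) (a ∷ b ∷ c ∷ []) (suc pc , m [ a ≔ m b /ℤ m c ])
  load   : ∀ {pc m a b p} → m b ≡ + p → Exec (load a b) (pc , m) (a ∷ b ∷ p ∷ []) (suc pc , m [ a ≔ m p ])
  store  : ∀ {pc m a b p} → m a ≡ + p → Exec (store a b) (pc , m) (a ∷ b ∷ p ∷ []) (suc pc , m [ p ≔ m b ])
  jump   : ∀ {pc m l} → Exec (jump l) (pc , m) [] (l , m)
  jzero₁ : ∀ {pc m a l} → m a ≡ 0ℤ → Exec (jzero a l) (pc , m) (a ∷ []) (l , m)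
  jzero₂ : ∀ {pc m a l} → m a ≢ 0ℤ → Exec (jzero a l) (pc , m) (a ∷ []) (suc pc , m)
  jneg₁  : ∀ {pc m a l} → m a <ℤ 0ℤ → Exec (jneg a l) (pc , m) (a ∷ []) (l , m)
  jneg₂  : ∀ {pc m a l} → ¬ (m a <ℤ 0ℤ) → Exec (jneg a l) (pc , m) (a ∷ []) (suc pc , m)

-- Run P c t as m: started in c, P halts after t instructions with final memory
-- m, and as lists (with repetitions) all registers accessed on the way.
data Run (P : Program) : Config → ℕ → List Addr → Memory → Set where
  halt : ∀ {pc m} → fetch P pc ≡ just halt → Run P (pc , m) 1 [] m
  step : ∀ {pc m ι c t as bs m′} → fetch P pc ≡ just ι → Exec ι (pc , m) as c →
         Run P c t bs m′ → Run P (pc , m) (suc t) (as ++ bs) m′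

space : List Addr → ℕ
space as = length (deduplicate _≟ℕ_ as)

input : ℕ → ℕ → ℕ → Memory
input r n k 0 = + r
input r n k 1 = + n
input r n k 2 = + k
input r n k _ = 0ℤ

-- The output word is stored letter by letter in consecutive registers, the
-- first of which is pointed to by R[0].
Outputs : ∀ {k} → Memory → Word k → Set
Outputs m w = ∃[ p ] (m 0 ≡ + p × (∀ i → m (p + toℕ i) ≡ + suc (toℕ (lookup w i))))

Computes : ∀ {k} → Program → Memory → Word k → (time-bound space-bound : ℕ) → Set
Computes P m₀ w T S =
  ∃[ t ] ∃[ as ] ∃[ m ] (Run P (0 , m₀) t as m × Outputs m w × t ≤ T × space as ≤ S)

{-# OPTIONS --safe #-}
-- The shortest border u of a bordered word w is unbordered and does not overlap itself,
-- so w = u v u with |u| ≤ |w|/2, and u is unique.  Hence, if A(L) is the number of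
-- unbordered words of length L that agree with a given prefix (with all of it, or with
-- as much of it as fits),
--   A(L) = #{words of length L agreeing with the prefix} − Σ_{1 ≤ i ≤ L/2} A(i) · E(L, i),
-- where E(L, i) is a product with one factor for each position in [i, L): k for a free
-- position, 1 for a fixed one, and 0 if the prefix contradicts the copy of u at the end.
-- Evaluating this naively costs O(n³) operations and O(n) registers.  The program fixes
-- the letters from left to right; for each position it tries the letters in increasing
-- order and lowers the rank by the count of every letter it skips, O(nk) counts in all.
module Submission where

open import Defs
open import Data.Nat using (ℕ; zero; suc; _+_; _*_; _∸_; _^_; _≤_; _<_; _≤?_; _<?_; _<ᵇ_; _≤ᵇ_; ⌊_/2⌋; z≤n; s≤s)
open import Data.Nat.Induction using (<-wellFounded)
open import Data.Nat.Logarithm using (⌊log₂_⌋; ⌊log₂⌋-mono-≤; ⌊log₂[2^n]⌋≡n)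
open import Data.Nat.Properties
open import Data.Nat.Tactic.RingSolver using (solve-∀)
open import Data.Fin using (Fin; toℕ; fromℕ<) renaming (zero to fzero; suc to fsuc)
open import Data.Fin.Properties using (toℕ<n; toℕ-fromℕ<; toℕ-injective; injective⇒≤; any?) renaming (_≟_ to _≟ᶠ_)
open import Data.List using (List; []; _∷_; _++_; _∷ʳ_; length; lookup; filter; deduplicate; map; tabulate; take; drop; cartesianProductWith)
open import Data.List.Properties using (≡-dec; length-++; length-take; length-drop; take++drop≡id; ++-assoc; ++-identityʳ; filter-++; map-++; map-∘; map-cong; map-id; ∷ʳ-++; ∷-injectiveˡ; ∷-injectiveʳ)
open import Data.List.Membership.Propositional.Properties using (∈-lookup)
open import Data.List.Relation.Unary.All as All using (All; []; _∷_)
import Data.List.Relation.Unary.All.Properties as All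
open import Data.List.Relation.Unary.Unique.Propositional using (Unique; _∷_)
open import Data.List.Relation.Unary.Unique.DecPropositional.Properties using (deduplicate-!)
open import Data.Bool using (Bool; true; false; T; if_then_else_)
open import Data.Bool.ListAction using (all)
open import Data.Maybe using (Maybe; just; nothing; fromMaybe; is-just)
open import Data.Product using (∃-syntax; Σ-syntax; _×_; _,_; proj₁)
open import Data.Sum using (_⊎_; inj₁; inj₂)
open import Data.Empty using (⊥)
open import Function using (id; _∘_)
open import Induction.WellFounded using (Acc; acc)
open import Relation.Nullary using (¬_; Dec; does; yes; no; contradiction)
open import Relation.Nullary.Decidable using (_×-dec_; map′)
open import Relation.Unary using (Decidable)
open import Relation.Binary using (tri<; tri≈; tri>)
open import Relation.Binary.PropositionalEquality using (_≡_; _≢_; refl; sym; trans; cong; cong₂; subst; subst₂; module ≡-Reasoning)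
open import Algebra.Properties.Semiring.Sum +-*-semiring using (sum-syntax; sum-cong-≗; ∑-distrib-+; *-distribˡ-sum)

open ≡-Reasoning

-- Two facts make the recurrence close on itself. A border is a prefix of its word, so it is subject
-- to the same known letters; hence the counts on the right are entries for the same prefix, and one
-- table in order of length suffices. The copy of the border at the end is also subject to the known
-- letters, so the number of completions might depend on the border. It does not: the known
-- positions form an initial segment and the copy lies to the right of its source, so a known letter
-- in the copy always repeats a known letter, and the constraint compares two letters of the prefix.
-- Counting is done additively in `ℕ`, starting from the identity 1 = [w unbordered] + sum over i of
-- [w has a shortest border of length i]. Subtraction appears only in the integer registers, where
-- this identity shows that the result is the intended natural number. The table is overwritten
-- whenever the prefix changes, which keeps the space linear.

private variable
  k : ℕ

-- Indicators, sums and products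

⟦_⟧ : ∀ {a} {A : Set a} → Dec A → ℕ
⟦ d ⟧ = if does d then 1 else 0

⟦⟧-yes : ∀ {a} {A : Set a} (d : Dec A) → A → ⟦ d ⟧ ≡ 1
⟦⟧-yes (yes _) _ = refl
⟦⟧-yes (no ¬a) a = contradiction a ¬a

⟦⟧-no : ∀ {a} {A : Set a} (d : Dec A) → ¬ A → ⟦ d ⟧ ≡ 0
⟦⟧-no (yes a) ¬a = contradiction a ¬a
⟦⟧-no (no _)  _  = refl

⟦⟧-× : ∀ {a b} {A : Set a} {B : Set b} (d : Dec A) (e : Dec B) → ⟦ d ×-dec e ⟧ ≡ ⟦ d ⟧ * ⟦ e ⟧
⟦⟧-× (no _)  _       = refl
⟦⟧-× (yes _) (no _)  = refl
⟦⟧-× (yes _) (yes _) = refl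

sumFrom prodFrom : ℕ → ℕ → (ℕ → ℕ) → ℕ
sumFrom s zero    f = 0
sumFrom s (suc d) f = f s + sumFrom (suc s) d f
prodFrom s zero    f = 1
prodFrom s (suc d) f = f s * prodFrom (suc s) d f

sumFrom-cong : ∀ s d {f g : ℕ → ℕ} → (∀ i → s ≤ i → i < s + d → f i ≡ g i) → sumFrom s d f ≡ sumFrom s d g
sumFrom-cong s zero    eq = refl
sumFrom-cong s (suc d) eq =
  cong₂ _+_ (eq s ≤-refl (m<m+n s (s≤s z≤n)))
    (sumFrom-cong (suc s) d (λ i s<i i< → eq i (<⇒≤ s<i) (subst (i <_) (sym (+-suc s d)) i<)))

sumFrom-zero : ∀ s d → sumFrom s d (λ _ → 0) ≡ 0
sumFrom-zero s zero    = refl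
sumFrom-zero s (suc d) = sumFrom-zero (suc s) d

sumFrom-single : ∀ s d {f : ℕ → ℕ} j → s ≤ j → j < s + d → (∀ i → s ≤ i → i < s + d → i ≢ j → f i ≡ 0) →
                 sumFrom s d f ≡ f j
sumFrom-single s zero    j s≤j j< _  = contradiction (subst (j <_) (+-identityʳ s) j<) (≤⇒≯ s≤j)
sumFrom-single s (suc d) {f} j s≤j j< off with s ≟ j
... | yes refl = begin
  f s + sumFrom (suc s) d f           ≡⟨ cong (f s +_) (sumFrom-cong (suc s) d rest) ⟩
  f s + sumFrom (suc s) d (λ _ → 0)   ≡⟨ cong (f s +_) (sumFrom-zero (suc s) d) ⟩
  f s + 0                             ≡⟨ +-identityʳ (f s) ⟩
  f s                                 ∎
  where
  rest : ∀ i → suc s ≤ i → i < suc s + d → f i ≡ 0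
  rest i s<i i< = off i (<⇒≤ s<i) (subst (i <_) (sym (+-suc s d)) i<) (λ i≡s → <⇒≢ s<i (sym i≡s))
... | no s≢j = trans
  (cong (_+ sumFrom (suc s) d f) (off s ≤-refl (m<m+n s (s≤s z≤n)) s≢j))
  (sumFrom-single (suc s) d j (≤∧≢⇒< s≤j s≢j) (subst (j <_) (+-suc s d) j<)
    (λ i s<i i< → off i (<⇒≤ s<i) (subst (i <_) (sym (+-suc s d)) i<)))

prodFrom-cong : ∀ s d {f g : ℕ → ℕ} → (∀ i → s ≤ i → i < s + d → f i ≡ g i) → prodFrom s d f ≡ prodFrom s d g
prodFrom-cong s zero    eq = refl
prodFrom-cong s (suc d) eq =
  cong₂ _*_ (eq s ≤-refl (m<m+n s (s≤s z≤n)))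
    (prodFrom-cong (suc s) d (λ i s<i i< → eq i (<⇒≤ s<i) (subst (i <_) (sym (+-suc s d)) i<)))

prodFrom-+ : ∀ s d e f → prodFrom s (d + e) f ≡ prodFrom s d f * prodFrom (s + d) e f
prodFrom-+ s zero    e f = trans (cong (λ x → prodFrom x e f) (sym (+-identityʳ s))) (sym (+-identityʳ _))
prodFrom-+ s (suc d) e f = begin
  f s * prodFrom (suc s) (d + e) f                             ≡⟨ cong (f s *_) (prodFrom-+ (suc s) d e f) ⟩
  f s * (prodFrom (suc s) d f * prodFrom (suc s + d) e f)      ≡⟨ *-assoc (f s) _ _ ⟨
  f s * prodFrom (suc s) d f * prodFrom (suc s + d) e f        ≡⟨ cong (λ x → f s * prodFrom (suc s) d f * prodFrom x e f) (+-suc s d) ⟨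
  f s * prodFrom (suc s) d f * prodFrom (s + suc d) e f        ∎

sum-delta : (a : Fin k) (g : Fin k → ℕ) → ∑[ b < k ] (⟦ a ≟ᶠ b ⟧ * g b) ≡ g a
sum-delta {suc k} fzero    g = begin
  g fzero + 0 + ∑[ b < k ] 0  ≡⟨ cong₂ _+_ (+-identityʳ _) (sym (*-distribˡ-sum 0 (λ (_ : Fin k) → 0))) ⟩
  g fzero + 0                 ≡⟨ +-identityʳ _ ⟩
  g fzero                     ∎
sum-delta {suc k} (fsuc a) g = sum-delta a (g ∘ fsuc)

-- Recursion on the first letter mirrors `words`, and lets sums be split along `u ++ v` and factors
-- be moved out without handling lists.
sumWords : ℕ → (Word k → ℕ) → ℕ
sumWords         zero    f = f []
sumWords {k = k} (suc L) f = ∑[ a < k ] sumWords L (λ w → f (a ∷ w))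

sumWords-cong : ∀ L {f g : Word k → ℕ} → (∀ w → length w ≡ L → f w ≡ g w) → sumWords L f ≡ sumWords L g
sumWords-cong zero    eq = eq [] refl
sumWords-cong (suc L) eq = sum-cong-≗ (λ a → sumWords-cong L (λ w len → eq (a ∷ w) (cong suc len)))

sumWords-+ : ∀ L (f g : Word k → ℕ) → sumWords L (λ w → f w + g w) ≡ sumWords L f + sumWords L g
sumWords-+ zero    f g = refl
sumWords-+ (suc L) f g =
  trans (sum-cong-≗ (λ a → sumWords-+ L (f ∘ (a ∷_)) (g ∘ (a ∷_))))
        (∑-distrib-+ (λ a → sumWords L (f ∘ (a ∷_))) (λ a → sumWords L (g ∘ (a ∷_))))

sumWords-* : ∀ L x (f : Word k → ℕ) → sumWords L (λ w → x * f w) ≡ x * sumWords L f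
sumWords-* zero    x f = refl
sumWords-* (suc L) x f =
  trans (sum-cong-≗ (λ a → sumWords-* L x (f ∘ (a ∷_))))
        (sym (*-distribˡ-sum x (λ a → sumWords L (f ∘ (a ∷_)))))

sumWords-++ : ∀ a b (f : Word k → ℕ) → sumWords (a + b) f ≡ sumWords a (λ u → sumWords b (λ v → f (u ++ v)))
sumWords-++ zero    b f = refl
sumWords-++ (suc a) b f = sum-cong-≗ (λ x → sumWords-++ a b (f ∘ (x ∷_)))

sumWords-sumFrom : ∀ L s d (f : ℕ → Word k → ℕ) →
  sumWords L (λ w → sumFrom s d (λ i → f i w)) ≡ sumFrom s d (λ i → sumWords L (f i))
sumWords-sumFrom L s zero    f = sumWords-* L 0 (λ _ → 0)
sumWords-sumFrom L s (suc d) f = begin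
  sumWords L (λ w → f s w + sumFrom (suc s) d (λ i → f i w))
    ≡⟨ sumWords-+ L (f s) _ ⟩
  sumWords L (f s) + sumWords L (λ w → sumFrom (suc s) d (λ i → f i w))
    ≡⟨ cong (sumWords L (f s) +_) (sumWords-sumFrom L (suc s) d f) ⟩
  sumWords L (f s) + sumFrom (suc s) d (λ i → sumWords L (f i))
    ∎

sumFrom-*ˡ : ∀ s d x (f : ℕ → ℕ) → x * sumFrom s d f ≡ sumFrom s d (λ i → x * f i)
sumFrom-*ˡ s zero    x f = *-zeroʳ x
sumFrom-*ˡ s (suc d) x f = trans (*-distribˡ-+ x (f s) _) (cong (x * f s +_) (sumFrom-*ˡ (suc s) d x f))

-- Partially known words

-- Total on `ℕ`, so that one pattern constrains words of every length: a word shorter than the known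
-- prefix is tested against as much of it as fits.
Pattern : ℕ → Set
Pattern k = ℕ → Maybe (Fin k)

matches : Maybe (Fin k) → Fin k → ℕ
matches nothing  b = 1
matches (just a) b = ⟦ a ≟ᶠ b ⟧

choices : Maybe (Fin k) → ℕ
choices {k} nothing = k
choices (just _)    = 1

compatible : Maybe (Fin k) → Maybe (Fin k) → ℕ
compatible x        nothing  = 1
compatible nothing  (just b) = 1
compatible (just a) (just b) = ⟦ a ≟ᶠ b ⟧

agrees : Pattern k → ℕ → Word k → ℕ
agrees c t []      = 1
agrees c t (a ∷ w) = matches (c t) a * agrees c (suc t) w

prefix : Word k → Pattern k
prefix []      t       = nothing
prefix (a ∷ p) zero    = just a
prefix (a ∷ p) (suc t) = prefix p t

-- The known positions form an initial segment, so a known position in the final copy of a border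
-- has a known source.
DownClosed : Pattern k → Set
DownClosed c = ∀ {s t} → s ≤ t → c s ≡ nothing → c t ≡ nothing

prefix-downClosed : (p : Word k) → DownClosed (prefix p)
prefix-downClosed []      _         _  = refl
prefix-downClosed (a ∷ p) (s≤s s≤t) eq = prefix-downClosed p s≤t eq

agrees-++ : ∀ (c : Pattern k) t u v → agrees c t (u ++ v) ≡ agrees c t u * agrees c (t + length u) v
agrees-++ c t []      v = trans (cong (λ x → agrees c x v) (sym (+-identityʳ t))) (sym (+-identityʳ _))
agrees-++ c t (a ∷ u) v = begin
  matches (c t) a * agrees c (suc t) (u ++ v)
    ≡⟨ cong (matches (c t) a *_) (agrees-++ c (suc t) u v) ⟩
  matches (c t) a * (agrees c (suc t) u * agrees c (suc t + length u) v)
    ≡⟨ *-assoc (matches (c t) a) _ _ ⟨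
  matches (c t) a * agrees c (suc t) u * agrees c (suc t + length u) v
    ≡⟨ cong (λ x → matches (c t) a * agrees c (suc t) u * agrees c x v) (+-suc t (length u)) ⟨
  matches (c t) a * agrees c (suc t) u * agrees c (t + suc (length u)) v
    ∎

agrees-suc : ∀ (c : Pattern k) t w → agrees c (suc t) w ≡ agrees (c ∘ suc) t w
agrees-suc c t []      = refl
agrees-suc c t (a ∷ w) = cong (matches (c (suc t)) a *_) (agrees-suc c (suc t) w)

agrees-prefix[] : ∀ t (w : Word k) → agrees (prefix []) t w ≡ 1
agrees-prefix[] t []      = refl
agrees-prefix[] t (a ∷ w) = trans (+-identityʳ _) (agrees-prefix[] (suc t) w)

sum-matches : (x : Maybe (Fin k)) → ∑[ a < k ] matches x a ≡ choices x
sum-matches {k} nothing  = ones k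
  where
  ones : ∀ j → ∑[ a < j ] 1 ≡ j
  ones zero    = refl
  ones (suc j) = cong suc (ones j)
sum-matches {k} (just a) =
  trans (sum-cong-≗ (λ b → sym (*-identityʳ ⟦ a ≟ᶠ b ⟧))) (sum-delta a (λ _ → 1))

sumWords-agrees : ∀ L (c : Pattern k) t → sumWords L (agrees c t) ≡ prodFrom t L (choices ∘ c)
sumWords-agrees         zero    c t = refl
sumWords-agrees {k = k} (suc L) c t = begin
  ∑[ a < k ] sumWords L (λ w → matches (c t) a * agrees c (suc t) w)
    ≡⟨ sum-cong-≗ (λ a → trans (sumWords-* L (matches (c t) a) _) (*-comm (matches (c t) a) X)) ⟩
  ∑[ a < k ] (X * matches (c t) a)
    ≡⟨ *-distribˡ-sum X (matches (c t)) ⟨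
  X * ∑[ a < k ] matches (c t) a
    ≡⟨ cong₂ _*_ (sumWords-agrees L c (suc t)) (sum-matches (c t)) ⟩
  prodFrom (suc t) L (choices ∘ c) * choices (c t)
    ≡⟨ *-comm _ (choices (c t)) ⟩
  choices (c t) * prodFrom (suc t) L (choices ∘ c)
    ∎
  where X = sumWords L (agrees c (suc t))

-- Bridge between the two ways of counting: the recurrence weights all words by agreement with a
-- pattern, whereas ranking runs over the completions of `p`.
sumWords-prefix : ∀ (p : Word k) l (f : Word k → ℕ) →
  sumWords (length p + l) (λ w → agrees (prefix p) 0 w * f w) ≡ sumWords l (λ v → f (p ++ v))
sumWords-prefix [] l f =
  sumWords-cong l (λ w _ → trans (cong (_* f w) (agrees-prefix[] 0 w)) (+-identityʳ _))
sumWords-prefix {k = k} (a ∷ p) l f = begin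
  ∑[ b < k ] sumWords (length p + l) (λ w → ⟦ a ≟ᶠ b ⟧ * agrees (prefix (a ∷ p)) 1 w * f (b ∷ w))
    ≡⟨ sum-cong-≗ (λ b → trans
         (sumWords-cong (length p + l) (λ w _ → trans
           (cong (λ x → ⟦ a ≟ᶠ b ⟧ * x * f (b ∷ w)) (agrees-suc (prefix (a ∷ p)) 0 w))
           (*-assoc ⟦ a ≟ᶠ b ⟧ _ _)))
         (sumWords-* (length p + l) ⟦ a ≟ᶠ b ⟧ _)) ⟩
  ∑[ b < k ] (⟦ a ≟ᶠ b ⟧ * sumWords (length p + l) (λ w → agrees (prefix p) 0 w * f (b ∷ w)))
    ≡⟨ sum-delta a (λ b → sumWords (length p + l) (λ w → agrees (prefix p) 0 w * f (b ∷ w))) ⟩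
  sumWords (length p + l) (λ w → agrees (prefix p) 0 w * f (a ∷ w))
    ≡⟨ sumWords-prefix p l (f ∘ (a ∷_)) ⟩
  sumWords l (λ v → f (a ∷ p ++ v))
    ∎

≡-dec-agrees : (u v : Word k) → length u ≡ length v → ⟦ ≡-dec _≟ᶠ_ u v ⟧ ≡ agrees (prefix u) 0 v
≡-dec-agrees []      []      _  = refl
≡-dec-agrees (a ∷ u) (b ∷ v) eq with ih ← ≡-dec-agrees u v (suc-injective eq) | a ≟ᶠ b
... | no _  = refl
... | yes _ = trans ih (trans (sym (agrees-suc (prefix (a ∷ u)) 0 v)) (sym (+-identityʳ _)))

sumWords-≡ : ∀ (u : Word k) (f : Word k → ℕ) → sumWords (length u) (λ v → ⟦ ≡-dec _≟ᶠ_ u v ⟧ * f v) ≡ f u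
sumWords-≡ u f = begin
  sumWords (length u) (λ v → ⟦ ≡-dec _≟ᶠ_ u v ⟧ * f v)
    ≡⟨ sumWords-cong (length u) (λ v len → cong (_* f v) (≡-dec-agrees u v (sym len))) ⟩
  sumWords (length u) (λ v → agrees (prefix u) 0 v * f v)
    ≡⟨ cong (λ x → sumWords x (λ v → agrees (prefix u) 0 v * f v)) (+-identityʳ (length u)) ⟨
  sumWords (length u + 0) (λ v → agrees (prefix u) 0 v * f v)
    ≡⟨ sumWords-prefix u 0 f ⟩
  f (u ++ [])
    ≡⟨ cong f (++-identityʳ u) ⟩
  f u ∎

-- Once `x` is known to be `just a`, testing `a` against `y` is testing `x` against `y`. The
-- hypothesis excludes an unknown letter facing a known one, where the left side would depend on
-- `a`.
matches-compatible : (x y : Maybe (Fin k)) (a : Fin k) → (x ≡ nothing → y ≡ nothing) →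
  matches x a * matches y a ≡ matches x a * compatible x y
matches-compatible x        nothing  a _ = refl
matches-compatible nothing  (just b) a h with () ← h refl
matches-compatible (just b) (just c) a _ with b ≟ᶠ a
... | no _     = refl
... | yes refl with c ≟ᶠ b | b ≟ᶠ c
...   | yes _  | yes _  = refl
...   | no _   | no _   = refl
...   | yes eq | no neq = contradiction (sym eq) neq
...   | no neq | yes eq = contradiction (sym eq) neq

-- Removes `u` from the condition on its second copy, `d` places to the right: only its length
-- remains in that factor.
agrees-twice : ∀ (c : Pattern k) → DownClosed c → ∀ d s u →
  agrees c s u * agrees c (d + s) u ≡ agrees c s u * prodFrom (d + s) (length u) (λ t → compatible (c (t ∸ d)) (c t))
agrees-twice c dc d s []      = refl
agrees-twice c dc d s (a ∷ u) = begin
  x * xs * (y * ys)          ≡⟨ [m*n]*[o*p]≡[m*o]*[n*p] x xs y ys ⟩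
  x * y * (xs * ys)          ≡⟨ cong₂ _*_ (matches-compatible (c s) (c (d + s)) a (dc (m≤n+m s d))) rest ⟩
  x * z * (xs * zs)          ≡⟨ [m*n]*[o*p]≡[m*o]*[n*p] x z xs zs ⟩
  x * xs * (z * zs)          ≡⟨ cong (λ r → x * xs * (compatible (c r) (c (d + s)) * zs)) (m+n∸m≡n d s) ⟨
  x * xs * (compatible (c (d + s ∸ d)) (c (d + s)) * zs) ∎
  where
  x = matches (c s) a
  y = matches (c (d + s)) a
  z = compatible (c s) (c (d + s))
  xs = agrees c (suc s) u
  ys = agrees c (suc (d + s)) u
  F = λ t → compatible (c (t ∸ d)) (c t)
  zs = prodFrom (suc (d + s)) (length u) F
  rest : xs * ys ≡ xs * zs
  rest = subst (λ r → xs * agrees c r u ≡ xs * prodFrom r (length u) F) (+-suc d s) (agrees-twice c dc d (suc s) u)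

-- Shortest borders

++-cut : (u v u′ v′ : Word k) → u ++ v ≡ u′ ++ v′ → length u ≤ length u′ →
         ∃[ x ] (u′ ≡ u ++ x × v ≡ x ++ v′)
++-cut []      v u′       v′ eq _         = u′ , refl , eq
++-cut (a ∷ u) v (b ∷ u′) v′ eq (s≤s len) =
  let x , eqᵘ , eqᵛ = ++-cut u v u′ v′ (∷-injectiveʳ eq) len
  in  x , cong₂ _∷_ (sym (∷-injectiveˡ eq)) eqᵘ , eqᵛ

≢[]⇒0<length : {v : Word k} → v ≢ [] → 0 < length v
≢[]⇒0<length {v = []}    ne = contradiction refl ne
≢[]⇒0<length {v = _ ∷ _} _  = s≤s z≤n

0<length⇒≢[] : {v : Word k} → 0 < length v → v ≢ []
0<length⇒≢[] () refl

length-<-++ : (u v : Word k) → v ≢ [] → length u < length (u ++ v)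
length-<-++ u v ne = subst (length u <_) (sym (length-++ u)) (m<m+n (length u) (≢[]⇒0<length ne))

border-length : {u w : Word k} → Border u w → length u < length w
border-length {u = u} (_ , (v , ne , refl) , _) = length-<-++ u v ne

border-trans : {u v w : Word k} → Border u v → Border v w → Border u w
border-trans {u = u} (ne , (x , nx , refl) , (y , ny , eq)) (_ , (x′ , nx′ , refl) , (y′ , ny′ , eq′)) =
  ne , (x ++ x′ , (λ e → nx (++-[]ˡ e)) , sym (++-assoc u x x′))
     , (y′ ++ y , (λ e → ny′ (++-[]ˡ e)) , trans (++-assoc y′ y u) (trans (cong (y′ ++_) eq) eq′))
  where
  ++-[]ˡ : ∀ {v w : Word _} → v ++ w ≡ [] → v ≡ []
  ++-[]ˡ {[]} _ = refl

++-cutʳ : (v u v′ u′ : Word k) → v ++ u ≡ v′ ++ u′ → length u ≤ length u′ → ∃[ x ] u′ ≡ x ++ u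
++-cutʳ v u v′ u′ eq len = let x , _ , eq′ = ++-cut v′ u′ v u (sym eq) v′≤v in x , eq′
  where
  v′≤v : length v′ ≤ length v
  v′≤v = +-cancelʳ-≤ (length u) _ _ (≤-trans (+-monoʳ-≤ (length v′) len)
    (≤-reflexive (trans (sym (length-++ v′)) (trans (cong length (sym eq)) (length-++ v)))))

-- Two prefixes of one word are nested, and so are two suffixes; the strict inequality makes both
-- complements non-empty.
border-nested : {u v w : Word k} → Border u w → Border v w → length u < length v → Border u v
border-nested {u = u} {v} (ne , (x , _ , eq) , (y , _ , eq′)) (_ , (x′ , _ , eqᵘ) , (y′ , _ , eqᵛ)) lt
  with z , refl , _ ← ++-cut u x v x′ (trans eq (sym eqᵘ)) (<⇒≤ lt)
  with z′ , ev ← ++-cutʳ y u y′ v (trans eq′ (sym eqᵛ)) (<⇒≤ lt)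
  = ne , (z , nz , refl) , (z′ , nz′ , sym ev)
  where
  nz : z ≢ []
  nz refl = <-irrefl (cong length (sym (++-identityʳ u))) lt
  nz′ : z′ ≢ []
  nz′ refl = <-irrefl (cong length (sym ev)) lt

-- The overlap of the two occurrences of u is a border of u.
long-border : {u w : Word k} → Border u w → length w < length u + length u → ¬ Unbordered u
long-border {u = u} {w} (_ , (v , nv , eq) , (v′ , nv′ , eq′)) long unb =
  let x , ux , vx = ++-cut v′ u u v (trans eq′ (sym eq)) (<⇒≤ v′<u) in
  unb (x , (λ e → <-irrefl (cong length (sym (trans ux (trans (cong (v′ ++_) e) (++-identityʳ v′))))) v′<u)
         , (v , nv , sym vx) , (v′ , nv′ , sym ux))
  where
  v′<u : length v′ < length u
  v′<u = +-cancelʳ-< (length u) _ _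
    (subst (_< length u + length u) (trans (cong length (sym eq′)) (length-++ v′)) long)

-- Borders are indexed by length so that they can be summed over. For `1 ≤ i ≤ ⌊ length w /2⌋` this
-- describes an unbordered border, which is the same as the shortest one.
record ShortBorder (i : ℕ) (w : Word k) : Set where
  constructor shortBorder
  field
    repeats : take i w ≡ drop (length w ∸ i) w
    minimal : Unbordered (take i w)

shortBorder? : ∀ i (w : Word k) → Dec (ShortBorder i w)
shortBorder? i w = map′ (λ { (r , m) → shortBorder r m }) (λ { (shortBorder r m) → r , m })
  (≡-dec _≟ᶠ_ (take i w) (drop (length w ∸ i) w) ×-dec unbordered? (take i w))

length-take-≤ : ∀ i (w : Word k) → i ≤ length w → length (take i w) ≡ i
length-take-≤ i w le = trans (length-take i w) (m≤n⇒m⊓n≡m le)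

≤⌊/2⌋⇒+≤ : ∀ {i} L → i ≤ ⌊ L /2⌋ → i + i ≤ L
≤⌊/2⌋⇒+≤ L le = ≤-trans (+-mono-≤ le (≤-trans le (⌊n/2⌋≤⌈n/2⌉ L))) (≤-reflexive (⌊n/2⌋+⌈n/2⌉≡n L))

+≤⇒≤⌊/2⌋ : ∀ {i} L → i + i ≤ L → i ≤ ⌊ L /2⌋
+≤⇒≤⌊/2⌋ {i} L le = subst (_≤ ⌊ L /2⌋) (sym (n≡⌊n+n/2⌋ i)) (⌊n/2⌋-mono le)

shortBorder⇒border : ∀ i (w : Word k) → 1 ≤ i → i ≤ ⌊ length w /2⌋ → ShortBorder i w → Border (take i w) w
shortBorder⇒border i w 1≤i i≤h (shortBorder rep _) =
  0<length⇒≢[] (subst (0 <_) (sym len) 1≤i)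
  , (drop i w , 0<length⇒≢[] (subst (0 <_) (sym (length-drop i w)) 0<L∸i) , take++drop≡id i w)
  , (take (L ∸ i) w
    , 0<length⇒≢[] (subst (0 <_) (sym (length-take-≤ (L ∸ i) w (m∸n≤m L i))) 0<L∸i)
    , trans (cong (take (L ∸ i) w ++_) rep) (take++drop≡id (L ∸ i) w))
  where
  L = length w
  i+i≤L = ≤⌊/2⌋⇒+≤ L i≤h
  len = length-take-≤ i w (≤-trans (m≤m+n i i) i+i≤L)
  0<L∸i : 0 < L ∸ i
  0<L∸i = ≤-trans 1≤i (m+n≤o⇒m≤o∸n i i+i≤L)

take-length-++ : (u : Word k) {v : Word k} → take (length u) (u ++ v) ≡ u
take-length-++ []      = refl
take-length-++ (a ∷ u) = cong (a ∷_) (take-length-++ u)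

drop-length-++ : (u : Word k) {v : Word k} → drop (length u) (u ++ v) ≡ v
drop-length-++ []      = refl
drop-length-++ (a ∷ u) = drop-length-++ u

drop-suffix : (v u : Word k) → drop (length (v ++ u) ∸ length u) (v ++ u) ≡ u
drop-suffix v u = trans
  (cong (λ x → drop x (v ++ u)) (trans (cong (_∸ length u) (length-++ v)) (m+n∸n≡m (length v) (length u))))
  (drop-length-++ v)

border⇒shortBorder : {u w : Word k} → Border u w → Unbordered u → ShortBorder (length u) w
border⇒shortBorder {u = u} {w} (_ , (v , _ , eq) , (v′ , _ , eq′)) unb =
  shortBorder (trans tk (sym dp)) (subst Unbordered (sym tk) unb)
  where
  tk : take (length u) w ≡ u
  tk = trans (cong (take (length u)) (sym eq)) (take-length-++ u)
  dp : drop (length w ∸ length u) w ≡ u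
  dp = subst (λ x → drop (length x ∸ length u) x ≡ u) eq′ (drop-suffix v′ u)

-- Descent on the length of a border: if it is bordered, its own border is a shorter border of `w`;
-- if it is unbordered, `long-border` forces it into the first half, where none exists.
no-shortBorder⇒unbordered : (w : Word k) →
  (∀ i → 1 ≤ i → i ≤ ⌊ length w /2⌋ → ¬ ShortBorder i w) → Unbordered w
no-shortBorder⇒unbordered w none (u₀ , b₀) = go u₀ b₀ (<-wellFounded _)
  where
  go : ∀ u → Border u w → Acc _<_ (length u) → ⊥
  go u b (acc rec) with unbordered? u
  ... | no ¬unb = ¬unb λ (v , bv) → go v (border-trans bv b) (rec (border-length bv))
  ... | yes unb with length u + length u ≤? length w
  ...   | yes le  = none (length u) (≢[]⇒0<length (proj₁ b)) (+≤⇒≤⌊/2⌋ (length w) le) (border⇒shortBorder b unb)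
  ...   | no long = long-border b (≰⇒> long) unb

length-take-half : ∀ i (w : Word k) → i ≤ ⌊ length w /2⌋ → length (take i w) ≡ i
length-take-half i w le = length-take-≤ i w (≤-trans le (⌊n/2⌋≤n (length w)))

-- Of two different lengths, the shorter border would be a border of the longer one, which is
-- unbordered.
shortBorder-unique : (w : Word k) → ∀ {i j} → 1 ≤ i → i ≤ ⌊ length w /2⌋ → 1 ≤ j → j ≤ ⌊ length w /2⌋ →
  ShortBorder i w → ShortBorder j w → i ≡ j
shortBorder-unique w {i} {j} 1≤i i≤h 1≤j j≤h si sj with <-cmp i j
... | tri≈ _ eq _ = eq
... | tri< i<j _ _ = contradiction
  (_ , border-nested (shortBorder⇒border i w 1≤i i≤h si) (shortBorder⇒border j w 1≤j j≤h sj)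
         (subst₂ _<_ (sym (length-take-half i w i≤h)) (sym (length-take-half j w j≤h)) i<j))
  (ShortBorder.minimal sj)
... | tri> _ _ j<i = contradiction
  (_ , border-nested (shortBorder⇒border j w 1≤j j≤h sj) (shortBorder⇒border i w 1≤i i≤h si)
         (subst₂ _<_ (sym (length-take-half j w j≤h)) (sym (length-take-half i w i≤h)) j<i))
  (ShortBorder.minimal si)

-- A partition of unity: exactly one of the indicators on the right equals 1.
unbordered-or-shortBorder : (w : Word k) →
  1 ≡ ⟦ unbordered? w ⟧ + sumFrom 1 ⌊ length w /2⌋ (λ i → ⟦ shortBorder? i w ⟧)
unbordered-or-shortBorder w with any? {n = ⌊ length w /2⌋} (λ i → shortBorder? (suc (toℕ i)) w)
... | yes (j , sj) = sym (cong₂ _+_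
  (⟦⟧-no (unbordered? w) (λ unb → unb (_ , shortBorder⇒border _ w (s≤s z≤n) (toℕ<n j) sj)))
  (trans
    (sumFrom-single 1 ⌊ length w /2⌋ (suc (toℕ j)) (s≤s z≤n) (s≤s (toℕ<n j))
      (λ i 1≤i i≤h i≢j → ⟦⟧-no (shortBorder? i w) (λ si →
        i≢j (shortBorder-unique w 1≤i (≤-pred i≤h) (s≤s z≤n) (toℕ<n j) si sj))))
    (⟦⟧-yes (shortBorder? (suc (toℕ j)) w) sj)))
... | no none = sym (cong₂ _+_
  (⟦⟧-yes (unbordered? w) (no-shortBorder⇒unbordered w none′))
  (trans (sumFrom-cong 1 ⌊ length w /2⌋ (λ i 1≤i i≤h → ⟦⟧-no (shortBorder? i w) (none′ i 1≤i (≤-pred i≤h))))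
         (sumFrom-zero 1 ⌊ length w /2⌋)))
  where
  none′ : ∀ i → 1 ≤ i → i ≤ ⌊ length w /2⌋ → ¬ ShortBorder i w
  none′ (suc i) _ i<h s = none (fromℕ< i<h , subst (λ x → ShortBorder (suc x) w) (sym (toℕ-fromℕ< i<h)) s)

-- Counting by shortest border

countUnbordered : Pattern k → ℕ → ℕ
countUnbordered c L = sumWords L (λ w → agrees c 0 w * ⟦ unbordered? w ⟧)

-- The number of ways to fill position t ∈ [i, L) of a word of length L that agrees
-- with c, once its first i letters are fixed and repeated at its end.
fillings : Pattern k → (L i t : ℕ) → ℕ
fillings c L i t with L ≤? t + i
... | no  _ = choices (c t)
... | yes _ = compatible (c (t + i ∸ L)) (c t)

extensions : Pattern k → (L i : ℕ) → ℕ
extensions c L i = prodFrom i (L ∸ i) (fillings c L i)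

-- With `i = 0` no position below `L` is forced, so the full count is the case `i = 0` of the same
-- product.
sumWords-agrees-all : ∀ (c : Pattern k) L → sumWords L (agrees c 0) ≡ extensions c L 0
sumWords-agrees-all c L = trans (sumWords-agrees L c 0) (prodFrom-cong 0 L (λ t _ t<L → sym (free t t<L)))
  where
  free : ∀ t → t < L → fillings c L 0 t ≡ choices (c t)
  free t t<L with L ≤? t + 0
  ... | no _   = refl
  ... | yes le = contradiction (subst (L ≤_) (+-identityʳ t) le) (<⇒≱ t<L)

⟦shortBorder?⟧ : ∀ i (w : Word k) →
  ⟦ shortBorder? i w ⟧ ≡ ⟦ ≡-dec _≟ᶠ_ (take i w) (drop (length w ∸ i) w) ⟧ * ⟦ unbordered? (take i w) ⟧
⟦shortBorder?⟧ i w = ⟦⟧-× (≡-dec _≟ᶠ_ (take i w) (drop (length w ∸ i) w)) (unbordered? (take i w))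

-- Split the word as u v u′. The border test becomes [u = u′] · [u unbordered], so the sum over u′
-- collapses to u′ = u; the sum over v is a free product; and `agrees-twice` makes the factor of the
-- last block independent of u, so that it leaves the sum over u.
sumWords-shortBorder : ∀ (c : Pattern k) → DownClosed c → ∀ i j →
  sumWords (i + (j + i)) (λ w → agrees c 0 w * ⟦ shortBorder? i w ⟧) ≡
  countUnbordered c i * extensions c (i + (j + i)) i
sumWords-shortBorder c dc i j = begin
  sumWords (i + (j + i)) (λ w → agrees c 0 w * ⟦ shortBorder? i w ⟧)
    ≡⟨ sumWords-++ i (j + i) _ ⟩
  sumWords i (λ u → sumWords (j + i) (λ x → agrees c 0 (u ++ x) * ⟦ shortBorder? i (u ++ x) ⟧))
    ≡⟨ sumWords-cong i inner ⟩
  sumWords i (λ u → E * (agrees c 0 u * ⟦ unbordered? u ⟧))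
    ≡⟨ sumWords-* i E _ ⟩
  E * countUnbordered c i
    ≡⟨ *-comm E _ ⟩
  countUnbordered c i * E
    ∎
  where
  L = i + (j + i)
  E = extensions c L i
  free    = prodFrom i j (choices ∘ c)
  forced  = prodFrom (i + j) i (λ t → compatible (c (t ∸ (i + j))) (c t))

  E≡ : E ≡ free * forced
  E≡ = begin
    prodFrom i (L ∸ i) (fillings c L i)
      ≡⟨ cong (λ x → prodFrom i x (fillings c L i)) (m+n∸m≡n i (j + i)) ⟩
    prodFrom i (j + i) (fillings c L i)
      ≡⟨ prodFrom-+ i j i _ ⟩
    prodFrom i j (fillings c L i) * prodFrom (i + j) i (fillings c L i)
      ≡⟨ cong₂ _*_ (prodFrom-cong i j left) (prodFrom-cong (i + j) i right) ⟩
    free * forced ∎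
    where
    left : ∀ t → i ≤ t → t < i + j → fillings c L i t ≡ choices (c t)
    left t _ t< with L ≤? t + i
    ... | no _   = refl
    ... | yes le = contradiction (+-cancelʳ-≤ i (i + j) t (subst (_≤ t + i) (sym (+-assoc i j i)) le)) (<⇒≱ t<)
    right : ∀ t → i + j ≤ t → t < i + j + i → fillings c L i t ≡ compatible (c (t ∸ (i + j))) (c t)
    right t ≤t _ with L ≤? t + i
    ... | no nle = contradiction (subst (_≤ t + i) (+-assoc i j i) (+-monoˡ-≤ i ≤t)) nle
    ... | yes _  = cong (λ x → compatible (c x) (c t)) (begin
      t + i ∸ (i + (j + i))  ≡⟨ cong₂ _∸_ (+-comm t i) (cong (i +_) (+-comm j i)) ⟩
      i + t ∸ (i + (i + j))  ≡⟨ [m+n]∸[m+o]≡n∸o i t (i + j) ⟩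
      t ∸ (i + j)            ∎)

  split : ∀ (u v u′ : Word _) → length u ≡ i → length v ≡ j → length u′ ≡ i →
    agrees c 0 (u ++ (v ++ u′)) * ⟦ shortBorder? i (u ++ (v ++ u′)) ⟧ ≡
    ⟦ ≡-dec _≟ᶠ_ u u′ ⟧ * (agrees c 0 u * agrees c i v * agrees c (i + j) u′ * ⟦ unbordered? u ⟧)
  split u v u′ refl refl eq = begin
    agrees c 0 (u ++ (v ++ u′)) * ⟦ shortBorder? i (u ++ (v ++ u′)) ⟧
      ≡⟨ cong₂ _*_ (trans (agrees-++ c 0 u _) (cong (agrees c 0 u *_) (agrees-++ c i v u′))) border ⟩
    agrees c 0 u * (agrees c i v * agrees c (i + j) u′) * (⟦ ≡-dec _≟ᶠ_ u u′ ⟧ * ⟦ unbordered? u ⟧)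
      ≡⟨ arrange (agrees c 0 u) (agrees c i v) (agrees c (i + j) u′) ⟦ ≡-dec _≟ᶠ_ u u′ ⟧ ⟦ unbordered? u ⟧ ⟩
    ⟦ ≡-dec _≟ᶠ_ u u′ ⟧ * (agrees c 0 u * agrees c i v * agrees c (i + j) u′ * ⟦ unbordered? u ⟧) ∎
    where
    arrange : ∀ a b c d e → a * (b * c) * (d * e) ≡ d * (a * b * c * e)
    arrange = solve-∀
    suffix : drop (length (u ++ (v ++ u′)) ∸ i) (u ++ (v ++ u′)) ≡ u′
    suffix = subst₂ (λ x y → drop (length y ∸ x) y ≡ u′) eq (++-assoc u v u′) (drop-suffix (u ++ v) u′)
    border : ⟦ shortBorder? i (u ++ (v ++ u′)) ⟧ ≡ ⟦ ≡-dec _≟ᶠ_ u u′ ⟧ * ⟦ unbordered? u ⟧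
    border = trans (⟦shortBorder?⟧ i (u ++ (v ++ u′)))
      (cong₂ (λ x y → ⟦ ≡-dec _≟ᶠ_ x y ⟧ * ⟦ unbordered? x ⟧) (take-length-++ u) suffix)

  inner : ∀ u → length u ≡ i →
    sumWords (j + i) (λ x → agrees c 0 (u ++ x) * ⟦ shortBorder? i (u ++ x) ⟧) ≡ E * (agrees c 0 u * ⟦ unbordered? u ⟧)
  inner u len = begin
    sumWords (j + i) (λ x → agrees c 0 (u ++ x) * ⟦ shortBorder? i (u ++ x) ⟧)
      ≡⟨ sumWords-++ j i _ ⟩
    sumWords j (λ v → sumWords i (λ u′ → agrees c 0 (u ++ (v ++ u′)) * ⟦ shortBorder? i (u ++ (v ++ u′)) ⟧))
      ≡⟨ sumWords-cong j (λ v lv → trans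
           (sumWords-cong i (λ u′ lu′ → split u v u′ len lv lu′))
           (subst (λ x → sumWords x (λ u′ → ⟦ ≡-dec _≟ᶠ_ u u′ ⟧ * term v u′) ≡ term v u) len (sumWords-≡ u (term v)))) ⟩
    sumWords j (λ v → term v u)
      ≡⟨ sumWords-cong j (λ v _ → arrange (agrees c 0 u) (agrees c i v) (agrees c (i + j) u) ⟦ unbordered? u ⟧) ⟩
    sumWords j (λ v → agrees c 0 u * agrees c (i + j) u * ⟦ unbordered? u ⟧ * agrees c i v)
      ≡⟨ sumWords-* j (agrees c 0 u * agrees c (i + j) u * ⟦ unbordered? u ⟧) (agrees c i) ⟩
    agrees c 0 u * agrees c (i + j) u * ⟦ unbordered? u ⟧ * sumWords j (agrees c i)
      ≡⟨ cong₂ (λ x y → x * ⟦ unbordered? u ⟧ * y) twice (sumWords-agrees j c i) ⟩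
    agrees c 0 u * forced * ⟦ unbordered? u ⟧ * free
      ≡⟨ arrange′ (agrees c 0 u) forced ⟦ unbordered? u ⟧ free ⟩
    free * forced * (agrees c 0 u * ⟦ unbordered? u ⟧)
      ≡⟨ cong (_* (agrees c 0 u * ⟦ unbordered? u ⟧)) E≡ ⟨
    E * (agrees c 0 u * ⟦ unbordered? u ⟧)
      ∎
    where
    term : Word _ → Word _ → ℕ
    term v u′ = agrees c 0 u * agrees c i v * agrees c (i + j) u′ * ⟦ unbordered? u ⟧
    arrange : ∀ a b c d → a * b * c * d ≡ a * c * d * b
    arrange = solve-∀
    arrange′ : ∀ a b c d → a * b * c * d ≡ d * b * (a * c)
    arrange′ = solve-∀
    twice : agrees c 0 u * agrees c (i + j) u ≡ agrees c 0 u * forced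
    twice = subst₂ (λ x y → agrees c 0 u * agrees c x u
                          ≡ agrees c 0 u * prodFrom x y (λ t → compatible (c (t ∸ (i + j))) (c t)))
                   (+-identityʳ (i + j)) len (agrees-twice c dc (i + j) 0 u)

-- Weight the partition of unity by `agrees c 0 w`, sum over all words and exchange the sums. Since
-- 2i ≤ L, the length splits as i + (L - 2i) + i.
countUnbordered-recurrence : ∀ (c : Pattern k) → DownClosed c → ∀ L →
  extensions c L 0 ≡ countUnbordered c L + sumFrom 1 ⌊ L /2⌋ (λ i → countUnbordered c i * extensions c L i)
countUnbordered-recurrence c dc L = begin
  extensions c L 0
    ≡⟨ sumWords-agrees-all c L ⟨
  sumWords L (agrees c 0)
    ≡⟨ sumWords-cong L (λ { w refl → begin
         agrees c 0 w
           ≡⟨ *-identityʳ _ ⟨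
         agrees c 0 w * 1
           ≡⟨ cong (agrees c 0 w *_) (unbordered-or-shortBorder w) ⟩
         agrees c 0 w * (⟦ unbordered? w ⟧ + sumFrom 1 ⌊ L /2⌋ (λ i → ⟦ shortBorder? i w ⟧))
           ≡⟨ *-distribˡ-+ (agrees c 0 w) _ _ ⟩
         agrees c 0 w * ⟦ unbordered? w ⟧ + agrees c 0 w * sumFrom 1 ⌊ L /2⌋ (λ i → ⟦ shortBorder? i w ⟧)
           ≡⟨ cong (agrees c 0 w * ⟦ unbordered? w ⟧ +_) (sumFrom-*ˡ 1 ⌊ L /2⌋ (agrees c 0 w) _) ⟩
         agrees c 0 w * ⟦ unbordered? w ⟧ + sumFrom 1 ⌊ L /2⌋ (λ i → agrees c 0 w * ⟦ shortBorder? i w ⟧)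
           ∎ }) ⟩
  sumWords L (λ w → agrees c 0 w * ⟦ unbordered? w ⟧ + sumFrom 1 ⌊ L /2⌋ (λ i → agrees c 0 w * ⟦ shortBorder? i w ⟧))
    ≡⟨ sumWords-+ L _ _ ⟩
  countUnbordered c L + sumWords L (λ w → sumFrom 1 ⌊ L /2⌋ (λ i → agrees c 0 w * ⟦ shortBorder? i w ⟧))
    ≡⟨ cong (countUnbordered c L +_) (sumWords-sumFrom L 1 ⌊ L /2⌋ (λ i w → agrees c 0 w * ⟦ shortBorder? i w ⟧)) ⟩
  countUnbordered c L + sumFrom 1 ⌊ L /2⌋ (λ i → sumWords L (λ w → agrees c 0 w * ⟦ shortBorder? i w ⟧))
    ≡⟨ cong (countUnbordered c L +_) (sumFrom-cong 1 ⌊ L /2⌋ (λ i _ i≤h → at i (≤-pred i≤h))) ⟩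
  countUnbordered c L + sumFrom 1 ⌊ L /2⌋ (λ i → countUnbordered c i * extensions c L i)
    ∎
  where
  at : ∀ i → i ≤ ⌊ L /2⌋ →
    sumWords L (λ w → agrees c 0 w * ⟦ shortBorder? i w ⟧) ≡ countUnbordered c i * extensions c L i
  at i i≤h = subst
    (λ x → sumWords x (λ w → agrees c 0 w * ⟦ shortBorder? i w ⟧) ≡ countUnbordered c i * extensions c x i)
    eq (sumWords-shortBorder c dc i (L ∸ (i + i)))
    where
    arrange : ∀ i j → i + (j + i) ≡ j + (i + i)
    arrange = solve-∀
    eq : i + (L ∸ (i + i) + i) ≡ L
    eq = trans (arrange i (L ∸ (i + i))) (m∸n+n≡m (≤⌊/2⌋⇒+≤ L i≤h))

-- Ranks within the words extending a prefix

length-filter-[x] : ∀ {A : Set} {P : A → Set} (P? : Decidable P) x → length (filter P? (x ∷ [])) ≡ ⟦ P? x ⟧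
length-filter-[x] P? x with does (P? x)
... | true  = refl
... | false = refl

module _ {k : ℕ} where

  extending : Word k → ℕ → List (Word k)
  extending p l = filter unbordered? (map (p ++_) (words k l))

  -- Here `f` enumerates the letters still to be tried after `p`. Starting from `f = id`, which
  -- gives `extending p (suc l)`, this allows induction on their number.
  extendingBy : ∀ {j} → Word k → (Fin j → Fin k) → ℕ → List (Word k)
  extendingBy p f l = filter unbordered? (map (p ++_) (cartesianProductWith _∷_ (tabulate f) (words k l)))

  -- One comparison of the search: the block of the first untried letter heads the listing, so an
  -- index either falls in it or is lowered by its length.
  extendingBy-suc : ∀ {j} p (f : Fin (suc j) → Fin k) l →
    extendingBy p f l ≡ extending (p ∷ʳ f fzero) l ++ extendingBy p (f ∘ fsuc) l
  extendingBy-suc p f l = begin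
    filter unbordered? (map (p ++_) (map (f fzero ∷_) W ++ R))
      ≡⟨ cong (filter unbordered?) (map-++ (p ++_) (map (f fzero ∷_) W) R) ⟩
    filter unbordered? (map (p ++_) (map (f fzero ∷_) W) ++ map (p ++_) R)
      ≡⟨ filter-++ unbordered? (map (p ++_) (map (f fzero ∷_) W)) _ ⟩
    filter unbordered? (map (p ++_) (map (f fzero ∷_) W)) ++ filter unbordered? (map (p ++_) R)
      ≡⟨ cong (λ x → filter unbordered? x ++ filter unbordered? (map (p ++_) R))
           (trans (sym (map-∘ W)) (map-cong (λ v → sym (∷ʳ-++ p (f fzero) v)) W)) ⟩
    extending (p ∷ʳ f fzero) l ++ extendingBy p (f ∘ fsuc) l ∎
    where
    W = words k l
    R = cartesianProductWith _∷_ (tabulate (f ∘ fsuc)) W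

  length-extending : ∀ p l → length (extending p l) ≡ sumWords l (λ v → ⟦ unbordered? (p ++ v) ⟧)
  length-extendingBy : ∀ {j} p (f : Fin j → Fin k) l →
    length (extendingBy p f l) ≡ ∑[ i < j ] sumWords l (λ v → ⟦ unbordered? (p ++ f i ∷ v) ⟧)
  length-extending p zero    = length-filter-[x] unbordered? (p ++ [])
  length-extending p (suc l) = length-extendingBy p id l
  length-extendingBy {zero}  p f l = refl
  length-extendingBy {suc j} p f l = begin
    length (extendingBy p f l)
      ≡⟨ cong length (extendingBy-suc p f l) ⟩
    length (extending (p ∷ʳ f fzero) l ++ extendingBy p (f ∘ fsuc) l)
      ≡⟨ length-++ (extending (p ∷ʳ f fzero) l) ⟩
    length (extending (p ∷ʳ f fzero) l) + length (extendingBy p (f ∘ fsuc) l)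
      ≡⟨ cong₂ _+_
           (trans (length-extending (p ∷ʳ f fzero) l)
                  (sumWords-cong l (λ v _ → cong (λ x → ⟦ unbordered? x ⟧) (∷ʳ-++ p (f fzero) v))))
           (length-extendingBy p (f ∘ fsuc) l) ⟩
    ∑[ i < suc j ] sumWords l (λ v → ⟦ unbordered? (p ++ f i ∷ v) ⟧)
      ∎

  -- The length of a block is the number that the recurrence computes.
  length-extending-count : ∀ p l → length (extending p l) ≡ countUnbordered (prefix p) (length p + l)
  length-extending-count p l = trans (length-extending p l) (sym (sumWords-prefix p l (λ w → ⟦ unbordered? w ⟧)))

  unborderedWords≡extending : ∀ n → unborderedWords k n ≡ extending [] n
  unborderedWords≡extending n = cong (filter unbordered?) (sym (map-id (words k n)))

-- Indexing by a natural number keeps the index independent of the list while blocks are split off.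
-- It counts from 0, so index `ρ` means rank `suc ρ`.
data _[_]=_ {A : Set} : List A → ℕ → A → Set where
  here  : ∀ {x xs} → (x ∷ xs) [ 0 ]= x
  there : ∀ {x y xs i} → xs [ i ]= x → (y ∷ xs) [ suc i ]= x

[]=-++ˡ : ∀ {A : Set} (xs : List A) {ys i x} → (xs ++ ys) [ i ]= x → i < length xs → xs [ i ]= x
[]=-++ˡ (_ ∷ xs) here      _         = here
[]=-++ˡ (_ ∷ xs) (there p) (s≤s lt)  = there ([]=-++ˡ xs p lt)

[]=-++ʳ : ∀ {A : Set} (xs : List A) {ys i x} → (xs ++ ys) [ i ]= x → length xs ≤ i → ys [ i ∸ length xs ]= x
[]=-++ʳ []       p         _        = p
[]=-++ʳ (_ ∷ xs) (there p) (s≤s le) = []=-++ʳ xs p le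

-- Integer tests performed by the program

open import Data.Integer using (ℤ; +_; 0ℤ; 1ℤ; -1ℤ; _⊖_; +<+) renaming (-_ to -ℤ_; _+_ to _+ℤ_; _-_ to _-ℤ_; _*_ to _*ℤ_; _<_ to _<ℤ_)
import Data.Integer.Properties as ℤ

module _ {X Y : ℤ} {x y : ℕ} (eqˣ : X ≡ + x) (eqʸ : Y ≡ + y) where

  +-value : X +ℤ Y ≡ + (x + y)
  +-value = cong₂ _+ℤ_ eqˣ eqʸ

  *-value : X *ℤ Y ≡ + (x * y)
  *-value = trans (cong₂ _*ℤ_ eqˣ eqʸ) (sym (ℤ.pos-* x y))

  -‿value : X -ℤ Y ≡ x ⊖ y
  -‿value = trans (cong₂ _-ℤ_ eqˣ eqʸ) (ℤ.[+m]-[+n]≡m⊖n x y)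

⊖-negative : ∀ {x y} → x < y → x ⊖ y <ℤ 0ℤ
⊖-negative {x} {y} x<y = subst (x ⊖ y <ℤ_) (ℤ.n⊖n≡0 y) (ℤ.⊖-monoˡ-< y x<y)

⊖-nonnegative : ∀ {x y} → y ≤ x → ¬ (x ⊖ y <ℤ 0ℤ)
⊖-nonnegative y≤x lt with +<+ () ← subst (_<ℤ 0ℤ) (ℤ.⊖-≥ y≤x) lt

⊖-zero : ∀ {x y} → x ≡ y → x ⊖ y ≡ 0ℤ
⊖-zero {x} refl = ℤ.n⊖n≡0 x

⊖-nonzero : ∀ {x y} → x ≢ y → x ⊖ y ≢ 0ℤ
⊖-nonzero {x} {y} x≢y eq = x≢y (ℤ.+-injective (ℤ.i-j≡0⇒i≡j (+ x) (+ y) (trans (ℤ.[+m]-[+n]≡m⊖n x y) eq)))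

-- Bounded execution

module Machine (P : Program) (B : ℕ) (16≤B : 16 ≤ B) where

  infix 4 _⟶[_]_
  infixr 3 _⨾_ _⊕_ calc⟨_⟩_ _from⟨_,_,_⟩_ _at⟨_,_,_⟩_

  -- T is only an upper bound on the number of instructions: done holds for every T.
  data _⟶[_]_ : Config → ℕ → Config → Set where
    done : ∀ {c T} → c ⟶[ T ] c
    next : ∀ {pc m ι c as T c′} → fetch P pc ≡ just ι → Exec ι (pc , m) as c → All (_< B) as →
           c ⟶[ T ] c′ → (pc , m) ⟶[ suc T ] c′

  instrAt : Label → Instr
  instrAt pc = fromMaybe halt (fetch P pc)

  fetch-instrAt : ∀ pc → T (is-just (fetch P pc)) → fetch P pc ≡ just (instrAt pc)
  fetch-instrAt pc _ with just _ ← fetch P pc = refl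

  -- Addresses 0 to 15 are set aside for fixed registers and the arrays start at 16, so every direct
  -- access is checked by evaluation.
  register : ∀ {a} → T (a <ᵇ 16) → a < B
  register {a} lt = <-≤-trans (<ᵇ⇒< a 16 lt) 16≤B

  registers : ∀ as → T (all (_<ᵇ 16) as) → All (_< B) as
  registers as = All.map register ∘ All.all⁺ (_<ᵇ 16) as

  -- For a concrete program and label both hidden arguments evaluate to the unit type, so a jump
  -- needs only its semantic premise.
  _⨾_ : ∀ {pc m as c T′ c′} → Exec (instrAt pc) (pc , m) as c →
        {_ : T (is-just (fetch P pc))} {_ : T (all (_<ᵇ 16) as)} →
        c ⟶[ T′ ] c′ → (pc , m) ⟶[ suc T′ ] c′
  _⨾_ {pc} {as = as} e {f} {l} s = next (fetch-instrAt pc f) e (registers as l) s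

  simple : Instr → Bool
  simple (const a _) = a <ᵇ 16
  simple (move a b)  = all (_<ᵇ 16) (a ∷ b ∷ [])
  simple (add a b c) = all (_<ᵇ 16) (a ∷ b ∷ c ∷ [])
  simple (sub a b c) = all (_<ᵇ 16) (a ∷ b ∷ c ∷ [])
  simple (mul a b c) = all (_<ᵇ 16) (a ∷ b ∷ c ∷ [])
  simple _           = false

  target : Instr → Addr
  target (const a _) = a
  target (move a b)  = a
  target (add a b c) = a
  target (sub a b c) = a
  target (mul a b c) = a
  target _           = 0

  value : Instr → Memory → ℤ
  value (const a x) m = x
  value (move a b)  m = m b
  value (add a b c) m = m b +ℤ m c
  value (sub a b c) m = m b -ℤ m c
  value (mul a b c) m = m b *ℤ m c
  value _           m = 0ℤ

  simple-exec : ∀ ι {pc m} → T (simple ι) →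
    ∃[ as ] (Exec ι (pc , m) as (suc pc , m [ target ι ≔ value ι m ]) × All (_< B) as)
  simple-exec (const a _) s = _ , const , register s ∷ []
  simple-exec (move a b)  s = _ , move , registers (a ∷ b ∷ []) s
  simple-exec (add a b c) s = _ , add , registers (a ∷ b ∷ c ∷ []) s
  simple-exec (sub a b c) s = _ , sub , registers (a ∷ b ∷ c ∷ []) s
  simple-exec (mul a b c) s = _ , mul , registers (a ∷ b ∷ c ∷ []) s

  -- The written value is replaced by a propositionally equal x: otherwise the terms
  -- denoting memories grow exponentially with the number of instructions.
  calc⟨_⟩_ : ∀ {pc m x T′ c′} {f : T (is-just (fetch P pc))} {s : T (simple (instrAt pc))} →
             value (instrAt pc) m ≡ x →
             (suc pc , m [ target (instrAt pc) ≔ x ]) ⟶[ T′ ] c′ → (pc , m) ⟶[ suc T′ ] c′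
  calc⟨_⟩_ {pc} {f = f} {s} refl r =
    let _ , e , bnd = simple-exec (instrAt pc) s in next (fetch-instrAt pc f) e bnd r

  data IsLoad : Instr → Addr → Addr → Set where
    isLoad : ∀ {a b} → {_ : T (a <ᵇ 16)} {_ : T (b <ᵇ 16)} → IsLoad (load a b) a b

  data IsStore : Instr → Addr → Addr → Set where
    isStore : ∀ {a b} → {_ : T (a <ᵇ 16)} {_ : T (b <ᵇ 16)} → IsStore (store a b) a b

  -- The address `p` is computed at run time, so `p < B` is a premise instead of a closed check.
  _from⟨_,_,_⟩_ : ∀ {pc m a b p x T′ c′} {f : T (is-just (fetch P pc))} → IsLoad (instrAt pc) a b →
    m b ≡ + p → p < B → m p ≡ x →
    (suc pc , m [ a ≔ x ]) ⟶[ T′ ] c′ → (pc , m) ⟶[ suc T′ ] c′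
  _from⟨_,_,_⟩_ {pc} {f = f} il mb p<B refl r with instrAt pc | fetch-instrAt pc f | il
  ... | _ | eq | isLoad {_} {_} {a<} {b<} = next eq (load mb) (register a< ∷ register b< ∷ p<B ∷ []) r

  _at⟨_,_,_⟩_ : ∀ {pc m a b p x T′ c′} {f : T (is-just (fetch P pc))} → IsStore (instrAt pc) a b →
    m a ≡ + p → p < B → m b ≡ x →
    (suc pc , m [ p ≔ x ]) ⟶[ T′ ] c′ → (pc , m) ⟶[ suc T′ ] c′
  _at⟨_,_,_⟩_ {pc} {f = f} is ma p<B refl r with instrAt pc | fetch-instrAt pc f | is
  ... | _ | eq | isStore {_} {_} {a<} {b<} = next eq (store ma) (register a< ∷ register b< ∷ p<B ∷ []) r

  _⊕_ : ∀ {c T c′ T′ c″} → c ⟶[ T ] c′ → c′ ⟶[ T′ ] c″ → c ⟶[ T + T′ ] c″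
  relax : ∀ {c T T′ c′} → T ≤ T′ → c ⟶[ T ] c′ → c ⟶[ T′ ] c′
  relax _         done            = done
  relax (s≤s le)  (next f e as s) = next f e as (relax le s)
  _⊕_ {T = T} done s′ = relax (m≤n+m _ T) s′
  next f e as s ⊕ s′  = next f e as (s ⊕ s′)

  ⟶⇒Run : ∀ {c T pc m} → c ⟶[ T ] (pc , m) → fetch P pc ≡ just halt →
           ∃[ t ] ∃[ as ] (Run P c t as m × t ≤ suc T × All (_< B) as)
  ⟶⇒Run done            h = 1 , [] , halt h , s≤s z≤n , []
  ⟶⇒Run (next f e as s) h =
    let t , bs , run , le , bnd = ⟶⇒Run s h in suc t , _ , step f e run , s≤s le , All.++⁺ as bnd

-- Memory updates and frame conditions

≔-same : ∀ (m : Memory) a x → (m [ a ≔ x ]) a ≡ x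
≔-same m a x with a ≟ a
... | yes _  = refl
... | no neq = contradiction refl neq

≔-other : ∀ (m : Memory) {a b} x → b ≢ a → (m [ a ≔ x ]) b ≡ m b
≔-other m {a} {b} x neq with b ≟ a
... | yes eq = contradiction eq neq
... | no _   = refl

-- Only registers `lo` to 15 may differ. The registers are numbered so that each loop changes a
-- final segment: `lo` is 10 for the product over t, 8 for the sum over i, and 7 where only the
-- prefix data and the arrays must survive.
record Scratch (lo : ℕ) (m m′ : Memory) : Set where
  constructor scratch
  field
    low  : ∀ a {_ : T (a <ᵇ lo)} → m′ a ≡ m a
    high : ∀ x → m′ (16 + x) ≡ m (16 + x)
open Scratch

scratch-refl : ∀ {lo m} → Scratch lo m m
scratch-refl = scratch (λ _ → refl) (λ _ → refl)

scratch-trans : ∀ {lo m m′ m″} → Scratch lo m m′ → Scratch lo m′ m″ → Scratch lo m m″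
scratch-trans s s′ = scratch (λ a {lt} → trans (low s′ a {lt}) (low s a {lt})) (λ x → trans (high s′ x) (high s x))

scratch-weaken : ∀ {lo lo′ m m′} → lo ≤ lo′ → Scratch lo′ m m′ → Scratch lo m m′
scratch-weaken {lo} le s =
  scratch (λ a {lt} → low s a {<⇒<ᵇ (<-≤-trans (<ᵇ⇒< a lo lt) le)}) (high s)

scratch-≔ : ∀ {lo m m′} b x → {_ : T (lo ≤ᵇ b)} {_ : T (b <ᵇ 16)} → Scratch lo m m′ → Scratch lo m (m′ [ b ≔ x ])
scratch-≔ {lo} {m′ = m′} b x {ge} {lt} s = scratch
  (λ a {a<} → trans (≔-other m′ x (<⇒≢ (<-≤-trans (<ᵇ⇒< a lo a<) (≤ᵇ⇒≤ lo b ge)))) (low s a {a<}))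
  (λ y → trans (≔-other m′ {b} {16 + y} x (λ { refl → <⇒≱ (<ᵇ⇒< b 16 lt) (m≤m+n 16 y) })) (high s y))

-- The program

NEXT COUNT LLOOP ILOOP TLOOP MULK FIXED TNEXT TEND ISTORE DECIDE REJECT END : Label
NEXT   = 5
COUNT  = 10
LLOOP  = 11
ILOOP  = 16
TLOOP  = 21
MULK   = 29
FIXED  = 31
TNEXT  = 39
TEND   = 41
ISTORE = 47
DECIDE = 50
REJECT = 53
END    = 60

-- Registers: 0 remaining rank, 1 n, 2 k, 3 the constant 1, 4 length of the current prefix,
-- 5 address of its letters, 6 address of the table of counts, 7 L, 8 running value of
-- entry L, 9 i, 10 running product, 11 t, 12 and 13 temporaries.
program : Program
program =
    const 3 1ℤ
  ∷ const 5 (+ 16)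
  ∷ add 6 5 1
  -- Entry 0 of the table is written once; later table writes concern entries from 1 on.
  ∷ const 12 -1ℤ
  ∷ store 6 12
  -- NEXT
  ∷ sub 12 1 4
  ∷ jzero 12 END
  ∷ add 12 5 4
  -- Letters are stored as 1, ..., k, so the constant 1 doubles as the first letter.
  ∷ store 12 3
  ∷ add 4 3 4
  -- COUNT
  ∷ const 7 0ℤ
  -- LLOOP
  ∷ sub 12 1 7
  ∷ jzero 12 DECIDE
  ∷ add 7 3 7
  ∷ const 8 0ℤ
  ∷ const 9 0ℤ
  -- ILOOP
  ∷ add 12 9 9
  ∷ sub 12 7 12
  ∷ jneg 12 ISTORE
  ∷ const 10 1ℤ
  ∷ move 11 9
  -- TLOOP
  ∷ sub 12 7 11
  ∷ jzero 12 TEND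
  -- Register 12 becomes t + i - L: negative at a free position, otherwise the position being
  -- copied. Register 13 becomes t - |p|: negative where the prefix prescribes the letter.
  ∷ add 12 11 9
  ∷ sub 12 12 7
  ∷ sub 13 11 4
  ∷ jneg 13 FIXED
  ∷ jneg 12 MULK
  ∷ jump TNEXT
  -- MULK
  ∷ mul 10 10 2
  ∷ jump TNEXT
  -- FIXED
  ∷ jneg 12 TNEXT
  ∷ add 12 5 12
  ∷ load 12 12
  ∷ add 13 5 11
  ∷ load 13 13
  ∷ sub 12 12 13
  ∷ jzero 12 TNEXT
  ∷ const 10 0ℤ
  -- TNEXT
  ∷ add 11 3 11
  ∷ jump TLOOP
  -- TEND
  ∷ add 12 6 9
  ∷ load 12 12
  ∷ mul 12 12 10
  ∷ sub 8 8 12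
  ∷ add 9 3 9
  ∷ jump ILOOP
  -- ISTORE
  ∷ add 12 6 7
  ∷ store 12 8
  ∷ jump LLOOP
  -- DECIDE
  ∷ sub 12 8 0
  ∷ jneg 12 REJECT
  ∷ jump NEXT
  -- REJECT
  ∷ sub 0 0 8
  ∷ add 12 5 4
  ∷ sub 12 12 3
  ∷ load 13 12
  ∷ add 13 3 13
  ∷ store 12 13
  ∷ jump COUNT
  -- END
  ∷ move 0 5
  ∷ halt
  ∷ []

prefix-just : ∀ {k} (p : Word k) {t} → t < length p → ∃[ a ] prefix p t ≡ just a
prefix-just (a ∷ p) {zero}  _        = a , refl
prefix-just (a ∷ p) {suc t} (s≤s lt) = prefix-just p lt

prefix-nothing : ∀ {k} (p : Word k) {t} → length p ≤ t → prefix p t ≡ nothing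
prefix-nothing []      _        = refl
prefix-nothing (a ∷ p) (s≤s le) = prefix-nothing p le

filter-[x]-[]= : ∀ {A : Set} {P : A → Set} (P? : Decidable P) {x y i} → filter P? (x ∷ []) [ i ]= y → y ≡ x
filter-[x]-[]= P? {x} ix with does (P? x)
filter-[x]-[]= P? here | true = refl

lookup-injective : ∀ {A : Set} {xs : List A} → Unique xs → ∀ i j → lookup xs i ≡ lookup xs j → i ≡ j
lookup-injective (_ ∷ _)       fzero    fzero    _  = refl
lookup-injective (x∉ ∷ _)      fzero    (fsuc j) eq = contradiction eq (All.lookup x∉ (∈-lookup j))
lookup-injective (x∉ ∷ _)      (fsuc i) fzero    eq = contradiction (sym eq) (All.lookup x∉ (∈-lookup i))
lookup-injective (_ ∷ unique)  (fsuc i) (fsuc j) eq = cong fsuc (lookup-injective unique i j eq)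

-- The distinct addresses inject into `Fin B`.
space-bounded : ∀ {B} as → All (_< B) as → space as ≤ B
space-bounded {B} as bnd = injective⇒≤ {f = position} injective
  where
  xs = deduplicate _≟_ as
  bounded : ∀ i → lookup xs i < B
  bounded i = All.lookup (All.deduplicate⁺ _≟_ bnd) (∈-lookup i)
  position : Fin (length xs) → Fin B
  position i = fromℕ< (bounded i)
  injective : ∀ {i j} → position i ≡ position j → i ≡ j
  injective {i} {j} eq = lookup-injective (deduplicate-! _≟_ as) i j
    (trans (sym (toℕ-fromℕ< (bounded i))) (trans (cong toℕ eq) (toℕ-fromℕ< (bounded j))))

-- Correctness and cost of the program

module Unranking (n κ : ℕ) (0<n : 0 < n) where

  K : ℕ
  K = suc κ

  -- 16 fixed registers, n letters from address 16 on, and n + 1 table entries from address 16 + n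
  -- on.
  open Machine program (17 + (n + n)) (m≤m+n 16 (suc (n + n)))

  record Holds (p : Word K) (r : ℕ) (m : Memory) : Set where
    field
      rank    : m 0 ≡ + r
      size    : m 1 ≡ + n
      letters : m 2 ≡ + K
      one     : m 3 ≡ + 1
      len     : m 4 ≡ + length p
      base    : m 5 ≡ + 16
      table   : m 6 ≡ + (16 + n)
      letter  : ∀ {t a} → prefix p t ≡ just a → m (16 + t) ≡ + suc (toℕ a)

  holds-scratch : ∀ {p r m m′} → Scratch 7 m m′ → Holds p r m → Holds p r m′
  holds-scratch s h = record
    { rank    = trans (low s 0) rank
    ; size    = trans (low s 1) size
    ; letters = trans (low s 2) letters
    ; one     = trans (low s 3) one
    ; len     = trans (low s 4) len
    ; base    = trans (low s 5) base
    ; table   = trans (low s 6) table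
    ; letter  = λ {t} eq → trans (high s t) (letter eq)
    }
    where open Holds h

  address : ∀ {t} → t < n → 16 + t < 17 + (n + n)
  address t<n = s≤s (+-monoʳ-≤ 16 (≤-trans (<⇒≤ t<n) (m≤m+n n n)))

  -- Each loop costs iterations times body, plus its exit test (2, 3 and 2). The longest pass over a
  -- position takes 16 instructions; 11 = 5 + 6 and 8 = 5 + 3 are those before and after the inner
  -- loop; `suc n` makes room for i = 0. In `try-time`, 1 is the reset of L and 9 the cost of
  -- `reject`.
  T-time I-time L-time try-time : ℕ
  T-time   = n * 16 + 2
  I-time   = suc n * (11 + T-time) + 3
  L-time   = n * (8 + I-time) + 2
  try-time = 1 + (L-time + 9)

  module Loops (p : Word K) (p≤n : length p ≤ n) where

    c : Pattern K
    c = prefix p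

    letter-address : ∀ {t} → t < length p → 16 + t < 17 + (n + n)
    letter-address lt = address (<-≤-trans lt p≤n)

    -- The source of a forced letter is not to the right of it; if position t has a stored letter,
    -- so does its source, and both loads are meaningful.
    earlier : ∀ {L i} t → i ≤ L → t + i ∸ L ≤ t
    earlier {L} t i≤L = ≤-trans (∸-monoˡ-≤ L (+-monoʳ-≤ t i≤L)) (≤-reflexive (m+n∸n≡m t L))

    -- One case per path through the loop body: free or forced, beyond or within the prefix. A
    -- forced position within the prefix splits again on whether the two letters agree.
    fill : ∀ {r m L i t w} → Holds p r m → m 7 ≡ + L → m 9 ≡ + i → m 11 ≡ + t → m 10 ≡ + w → t < L → i ≤ L →
      ∃[ m′ ] ((TLOOP , m) ⟶[ 16 ] (TLOOP , m′) × Scratch 10 m m′ ×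
               m′ 11 ≡ + suc t × m′ 10 ≡ + (w * fillings c L i t))
    fill {m = m} {L} {i} {t} {w} h eL ei et ew t<L i≤L with L ≤? t + i | t <? length p
    ... | no free | no out rewrite prefix-nothing p (≮⇒≥ out) =
      _ , (calc⟨ -‿value eL et ⟩ jzero₂ (⊖-nonzero (>⇒≢ t<L))
           ⨾ calc⟨ +-value et ei ⟩ calc⟨ -‿value refl eL ⟩ calc⟨ -‿value et (Holds.len h) ⟩
           jneg₂ (⊖-nonnegative (≮⇒≥ out))
           ⨾ jneg₁ (⊖-negative (≰⇒> free))
           ⨾ calc⟨ *-value ew (Holds.letters h) ⟩ jump ⨾ calc⟨ +-value (Holds.one h) et ⟩ jump ⨾ done)
        , scratch-≔ 11 _ (scratch-≔ 10 _ (scratch-≔ 13 _ (scratch-≔ 12 _ (scratch-≔ 12 _ (scratch-≔ 12 _ scratch-refl)))))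
        , refl
        , refl
    ... | yes known | no out rewrite prefix-nothing p (≮⇒≥ out) =
      _ , (calc⟨ -‿value eL et ⟩ jzero₂ (⊖-nonzero (>⇒≢ t<L))
           ⨾ calc⟨ +-value et ei ⟩ calc⟨ -‿value refl eL ⟩ calc⟨ -‿value et (Holds.len h) ⟩
           jneg₂ (⊖-nonnegative (≮⇒≥ out))
           ⨾ jneg₂ (⊖-nonnegative known)
           ⨾ jump ⨾ calc⟨ +-value (Holds.one h) et ⟩ jump ⨾ done)
        , scratch-≔ 11 _ (scratch-≔ 13 _ (scratch-≔ 12 _ (scratch-≔ 12 _ (scratch-≔ 12 _ scratch-refl))))
        , refl
        , trans ew (cong +_ (sym (*-identityʳ w)))
    ... | no free | yes t<p with a , eqa ← prefix-just p t<p rewrite eqa =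
      _ , (calc⟨ -‿value eL et ⟩ jzero₂ (⊖-nonzero (>⇒≢ t<L))
           ⨾ calc⟨ +-value et ei ⟩ calc⟨ -‿value refl eL ⟩ calc⟨ -‿value et (Holds.len h) ⟩
           jneg₁ (⊖-negative t<p)
           ⨾ jneg₁ (⊖-negative (≰⇒> free))
           ⨾ calc⟨ +-value (Holds.one h) et ⟩ jump ⨾ done)
        , scratch-≔ 11 _ (scratch-≔ 13 _ (scratch-≔ 12 _ (scratch-≔ 12 _ (scratch-≔ 12 _ scratch-refl))))
        , refl
        , trans ew (cong +_ (sym (*-identityʳ w)))
    ... | yes known | yes t<p with a , eqa ← prefix-just p t<p
      with b , eqb ← prefix-just p (≤-<-trans (earlier t i≤L) t<p) rewrite eqa | eqb with b ≟ᶠ a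
    ...   | yes b≡a =
      _ , (calc⟨ -‿value eL et ⟩ jzero₂ (⊖-nonzero (>⇒≢ t<L))
           ⨾ calc⟨ +-value et ei ⟩ calc⟨ -‿value refl eL ⟩ calc⟨ -‿value et (Holds.len h) ⟩
           jneg₁ (⊖-negative t<p)
           ⨾ jneg₂ (⊖-nonnegative known)
           ⨾ calc⟨ +-value (Holds.base h) (ℤ.⊖-≥ known) ⟩
             isLoad from⟨ refl , letter-address (≤-<-trans (earlier t i≤L) t<p) , Holds.letter h eqb ⟩
             calc⟨ +-value (Holds.base h) et ⟩
             isLoad from⟨ refl , letter-address t<p , Holds.letter h eqa ⟩
             calc⟨ -‿value {x = suc (toℕ b)} {suc (toℕ a)} refl refl ⟩
             jzero₁ (⊖-zero {suc (toℕ b)} {suc (toℕ a)} (cong (suc ∘ toℕ) b≡a))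
           ⨾ calc⟨ +-value (Holds.one h) et ⟩ jump ⨾ done)
        , scratch-≔ 11 _ (scratch-≔ 12 _ (scratch-≔ 13 _ (scratch-≔ 13 _ (scratch-≔ 12 _ (scratch-≔ 12 _ (scratch-≔ 13 _ (scratch-≔ 12 _ (scratch-≔ 12 _ (scratch-≔ 12 _ scratch-refl)))))))))
        , refl
        , trans ew (cong +_ (sym (*-identityʳ w)))
    ...   | no b≢a =
      _ , (calc⟨ -‿value eL et ⟩ jzero₂ (⊖-nonzero (>⇒≢ t<L))
           ⨾ calc⟨ +-value et ei ⟩ calc⟨ -‿value refl eL ⟩ calc⟨ -‿value et (Holds.len h) ⟩
           jneg₁ (⊖-negative t<p)
           ⨾ jneg₂ (⊖-nonnegative known)
           ⨾ calc⟨ +-value (Holds.base h) (ℤ.⊖-≥ known) ⟩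
             isLoad from⟨ refl , letter-address (≤-<-trans (earlier t i≤L) t<p) , Holds.letter h eqb ⟩
             calc⟨ +-value (Holds.base h) et ⟩
             isLoad from⟨ refl , letter-address t<p , Holds.letter h eqa ⟩
             calc⟨ -‿value {x = suc (toℕ b)} {suc (toℕ a)} refl refl ⟩
             jzero₂ (⊖-nonzero {suc (toℕ b)} {suc (toℕ a)} (b≢a ∘ toℕ-injective ∘ suc-injective))
           ⨾ calc⟨ refl ⟩ calc⟨ +-value (Holds.one h) et ⟩ jump ⨾ done)
        , scratch-≔ 11 _ (scratch-≔ 10 _ (scratch-≔ 12 _ (scratch-≔ 13 _ (scratch-≔ 13 _ (scratch-≔ 12 _ (scratch-≔ 12 _ (scratch-≔ 13 _ (scratch-≔ 12 _ (scratch-≔ 12 _ (scratch-≔ 12 _ scratch-refl))))))))))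
        , refl
        , cong +_ (sym (*-zeroʳ w))

    T-loop : ∀ D {r m L i t w} → Holds p r m → m 7 ≡ + L → m 9 ≡ + i → m 11 ≡ + t → m 10 ≡ + w → t + D ≡ L → i ≤ L →
      ∃[ m′ ] ((TLOOP , m) ⟶[ D * 16 + 2 ] (TEND , m′) × Scratch 10 m m′ ×
               m′ 10 ≡ + (w * prodFrom t D (fillings c L i)))
    T-loop zero {w = w} h eL ei et ew eq i≤L =
      _ , (calc⟨ -‿value eL et ⟩ jzero₁ (⊖-zero (trans (sym eq) (+-identityʳ _))) ⨾ done)
        , scratch-≔ 12 _ scratch-refl
        , trans ew (cong +_ (sym (*-identityʳ w)))
    T-loop (suc D) {L = L} {i} {t} {w} h eL ei et ew eq i≤L =
      let m₁ , s₁ , sc₁ , et₁ , ew₁ = fill h eL ei et ew (subst (t <_) eq (m<m+n t (s≤s z≤n))) i≤L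
          m₂ , s₂ , sc₂ , ew₂ = T-loop D (holds-scratch (scratch-weaken (m≤m+n 7 3) sc₁) h)
            (trans (low sc₁ 7) eL) (trans (low sc₁ 9) ei) et₁ ew₁ (trans (sym (+-suc t D)) eq) i≤L
      in m₂ , (s₁ ⊕ s₂) , scratch-trans sc₁ sc₂
            , trans ew₂ (cong +_ (*-assoc w (fillings c L i t) _))

    entry : ℕ → ℤ
    entry zero    = -1ℤ
    entry (suc i) = + countUnbordered c (suc i)

    accumulate : ℕ → ℤ → ℕ → ℕ → ℤ
    accumulate L x i zero    = x
    accumulate L x i (suc d) = accumulate L (x -ℤ entry i *ℤ + extensions c L i) (suc i) d

    accumulate-suc : ∀ L x i d → accumulate L x (suc i) d ≡
      x -ℤ + sumFrom (suc i) d (λ i → countUnbordered c i * extensions c L i)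
    accumulate-suc L x i zero    = sym (ℤ.+-identityʳ x)
    accumulate-suc L x i (suc d) = begin
      accumulate L (x -ℤ + a *ℤ + e) (suc (suc i)) d   ≡⟨ accumulate-suc L (x -ℤ + a *ℤ + e) (suc i) d ⟩
      x -ℤ + a *ℤ + e -ℤ + s                           ≡⟨ cong (λ y → x -ℤ y -ℤ + s) (ℤ.pos-* a e) ⟨
      x -ℤ + (a * e) -ℤ + s                            ≡⟨ ℤ.+-assoc x (-ℤ (+ (a * e))) (-ℤ (+ s)) ⟩
      x +ℤ (-ℤ (+ (a * e)) +ℤ -ℤ (+ s))              ≡⟨ cong (x +ℤ_) (ℤ.neg-distrib-+ (+ (a * e)) (+ s)) ⟨
      x -ℤ + (a * e + s)                               ∎
      where
      a = countUnbordered c (suc i)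
      e = extensions c L (suc i)
      s = sumFrom (suc (suc i)) d (λ i → countUnbordered c i * extensions c L i)

    -- Entry 0 is −1 so that the full count extensions c L 0 and the bordered words
    -- that are subtracted from it enter through the same formula.
    accumulate-entry : ∀ L → accumulate (suc L) 0ℤ 0 (suc ⌊ suc L /2⌋) ≡ entry (suc L)
    accumulate-entry L = begin
      accumulate (suc L) (0ℤ -ℤ -1ℤ *ℤ + e) 1 ⌊ suc L /2⌋  ≡⟨ accumulate-suc (suc L) _ 0 ⌊ suc L /2⌋ ⟩
      0ℤ -ℤ -1ℤ *ℤ + e -ℤ + s                              ≡⟨ cong (_-ℤ + s) first ⟩
      -- The recurrence gives s ≤ e, so the integer difference is the truncated one.
      + e -ℤ + s                                           ≡⟨ trans (-‿value {x = e} {s} refl refl) (ℤ.⊖-≥ (≤-trans (m≤n+m s a) (≤-reflexive (sym eq)))) ⟩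
      + (e ∸ s)                                            ≡⟨ cong (λ y → + (y ∸ s)) eq ⟩
      + (a + s ∸ s)                                        ≡⟨ cong +_ (m+n∸n≡m a s) ⟩
      + a                                                  ∎
      where
      e = extensions c (suc L) 0
      a = countUnbordered c (suc L)
      s = sumFrom 1 ⌊ suc L /2⌋ (λ i → countUnbordered c i * extensions c (suc L) i)
      eq : e ≡ a + s
      eq = countUnbordered-recurrence c (prefix-downClosed p) (suc L)
      first : 0ℤ -ℤ -1ℤ *ℤ + e ≡ + e
      first = trans (ℤ.+-identityˡ _) (trans (cong -ℤ_ (ℤ.-1*i≡-i (+ e))) (ℤ.neg-involutive (+ e)))

    Table : ℕ → Memory → Set
    Table L m = ∀ {i} → i ≤ L → m (16 + (n + i)) ≡ entry i

    entry-address : ∀ {i} → i ≤ n → 16 + (n + i) < 17 + (n + n)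
    entry-address i≤n = s≤s (+-monoʳ-≤ 16 (+-monoʳ-≤ n i≤n))

    I-finish : ∀ {m i x w} → m 3 ≡ + 1 → m 6 ≡ + (16 + n) → m 8 ≡ x → m 9 ≡ + i → m 10 ≡ + w →
      m (16 + (n + i)) ≡ entry i → i ≤ n →
      ∃[ m′ ] ((TEND , m) ⟶[ 6 ] (ILOOP , m′) × Scratch 8 m m′ ×
               m′ 9 ≡ + suc i × m′ 8 ≡ x -ℤ entry i *ℤ + w)
    I-finish {i = i} {w = w} e1 eA ex ei ew eT i≤n =
      _ , (calc⟨ +-value eA ei ⟩ isLoad from⟨ refl , entry-address i≤n , eT ⟩
           calc⟨ cong (entry i *ℤ_) ew ⟩ calc⟨ cong (_-ℤ (entry i *ℤ + w)) ex ⟩ calc⟨ +-value e1 ei ⟩ jump ⨾ done)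
        , scratch-≔ 9 _ (scratch-≔ 8 _ (scratch-≔ 12 _ (scratch-≔ 12 _ (scratch-≔ 12 _ scratch-refl))))
        , refl , refl

    I-step : ∀ {r m L i x} → Holds p r m → Table L m → L < n → m 7 ≡ + suc L → m 9 ≡ + i → m 8 ≡ x →
      i ≤ ⌊ suc L /2⌋ →
      ∃[ m′ ] ((ILOOP , m) ⟶[ 11 + T-time ] (ILOOP , m′) × Scratch 8 m m′ ×
               m′ 9 ≡ + suc i × m′ 8 ≡ x -ℤ entry i *ℤ + extensions c (suc L) i)
    I-step {m = m} {L} {i} {x} h tab L<n eL ei ex i≤h =
      let sc : Scratch 10 m (m [ 12 ≔ + (i + i) ] [ 12 ≔ suc L ⊖ (i + i) ] [ 10 ≔ 1ℤ ] [ 11 ≔ + i ])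
          sc = scratch-≔ 11 _ (scratch-≔ 10 _ (scratch-≔ 12 _ (scratch-≔ 12 _ scratch-refl)))
          m₁ , s₁ , sc₁ , ew₁ = T-loop (suc L ∸ i) (holds-scratch (scratch-weaken (m≤m+n 7 3) sc) h)
            eL ei refl refl (m+[n∸m]≡n (m≤n⇒m≤1+n i≤L)) (m≤n⇒m≤1+n i≤L)
          sc₂ = scratch-trans sc sc₁
          m₂ , s₂ , sc₃ , rest = I-finish (trans (low sc₂ 3) (Holds.one h)) (trans (low sc₂ 6) (Holds.table h))
            (trans (low sc₂ 8) ex) (trans (low sc₂ 9) ei) (trans ew₁ (cong +_ (*-identityˡ _)))
            (trans (high sc₂ (n + i)) (tab i≤L)) (≤-trans i≤L (<⇒≤ L<n))
      in m₂ , relax time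
                (calc⟨ +-value ei ei ⟩ calc⟨ -‿value eL refl ⟩
                 jneg₂ (⊖-nonnegative (≤⌊/2⌋⇒+≤ (suc L) i≤h)) ⨾ calc⟨ refl ⟩ calc⟨ ei ⟩ s₁ ⊕ s₂)
            , scratch-trans (scratch-weaken (m≤m+n 8 2) sc₂) sc₃ , rest
      where
      -- Half of `suc L` is at most `L`, so the new entry depends only on entries already in the
      -- table.
      i≤L : i ≤ L
      i≤L = ≤-trans i≤h (≤-pred (⌊n/2⌋<n L))
      arrange : ∀ t → 5 + (t + 6) ≡ 11 + t
      arrange = solve-∀
      time : 5 + ((suc L ∸ i) * 16 + 2 + 6) ≤ 11 + T-time
      time = ≤-trans
        (+-monoʳ-≤ 5 (+-monoˡ-≤ 6 (+-monoˡ-≤ 2 (*-monoˡ-≤ 16 (≤-trans (m∸n≤m (suc L) i) L<n)))))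
        (≤-reflexive (arrange T-time))

    I-loop : ∀ d {r m L i x} → Holds p r m → Table L m → L < n → m 7 ≡ + suc L → m 9 ≡ + i → m 8 ≡ x →
      i + d ≡ suc ⌊ suc L /2⌋ →
      ∃[ m′ ] ((ILOOP , m) ⟶[ d * (11 + T-time) + 3 ] (ISTORE , m′) × Scratch 8 m m′ ×
               m′ 8 ≡ accumulate (suc L) x i d)
    I-loop zero {L = L} {i} h tab L<n eL ei ex eq =
      _ , (calc⟨ +-value ei ei ⟩ calc⟨ -‿value eL refl ⟩ jneg₁ (⊖-negative (≰⇒> past)) ⨾ done)
        , scratch-≔ 12 _ (scratch-≔ 12 _ scratch-refl)
        , ex
      where
      past : ¬ (i + i ≤ suc L)
      past le = 1+n≰n (subst (_≤ ⌊ suc L /2⌋) (trans (sym (+-identityʳ i)) eq) (+≤⇒≤⌊/2⌋ (suc L) le))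
    I-loop (suc d) {L = L} {i} h tab L<n eL ei ex eq =
      let m₁ , s₁ , sc₁ , ei₁ , ex₁ = I-step h tab L<n eL ei ex i≤h
          m₂ , s₂ , sc₂ , ex₂ = I-loop d (holds-scratch (scratch-weaken (m≤m+n 7 1) sc₁) h)
            (λ {i′} le → trans (high sc₁ (n + i′)) (tab le)) L<n (trans (low sc₁ 7) eL) ei₁ ex₁
            (trans (sym (+-suc i d)) eq)
      in m₂ , relax (≤-reflexive (sym (+-assoc (11 + T-time) (d * (11 + T-time)) 3))) (s₁ ⊕ s₂)
            , scratch-trans sc₁ sc₂ , ex₂
      where
      i≤h : i ≤ ⌊ suc L /2⌋
      i≤h = ≤-pred (subst (suc i ≤_) eq (subst (suc i ≤_) (sym (+-suc i d)) (s≤s (m≤m+n i d))))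

    prefix-just⇒< : ∀ {t a} → prefix p t ≡ just a → t < length p
    prefix-just⇒< {t} eq with t <? length p
    ... | yes lt = lt
    ... | no nlt with () ← trans (sym eq) (prefix-nothing p (≮⇒≥ nlt))

    holds-entry : ∀ {r m j x} → Holds p r m → Holds p r (m [ 16 + (n + j) ≔ x ])
    holds-entry {m = m} {j} {x} h = record
      { rank = rank ; size = size ; letters = letters ; one = one ; len = len ; base = base ; table = table
      ; letter = λ {t} eq → trans
          (≔-other m {16 + (n + j)} {16 + t} x
            (<⇒≢ (s≤s (+-monoʳ-≤ 15 (≤-trans (<-≤-trans (prefix-just⇒< eq) p≤n) (m≤m+n n j))))))
          (letter eq)
      }
      where open Holds h

    table-entry : ∀ {L m} → Table L m → Table (suc L) (m [ 16 + (n + suc L) ≔ entry (suc L) ])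
    table-entry {L} {m} tab {i} le with m≤n⇒m<n∨m≡n le
    ... | inj₁ i<L  = trans (≔-other m _ (<⇒≢ (+-monoʳ-< (16 + n) i<L))) (tab (≤-pred i<L))
    ... | inj₂ refl = ≔-same m (16 + (n + suc L)) _

    L-step : ∀ {r m L} → Holds p r m → Table L m → m 7 ≡ + L → L < n →
      ∃[ m′ ] ((LLOOP , m) ⟶[ 8 + I-time ] (LLOOP , m′) × Holds p r m′ × Table (suc L) m′ ×
               m′ 7 ≡ + suc L × m′ 8 ≡ entry (suc L))
    L-step {r} {m} {L} h tab eL L<n =
      let sc : Scratch 7 m (m [ 12 ≔ n ⊖ L ] [ 7 ≔ + suc L ] [ 8 ≔ 0ℤ ] [ 9 ≔ 0ℤ ])
          sc = scratch-≔ 9 _ (scratch-≔ 8 _ (scratch-≔ 7 _ (scratch-≔ 12 _ scratch-refl)))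
          m₁ , s₁ , sc₁ , ex₁ = I-loop (suc ⌊ suc L /2⌋) (holds-scratch sc h)
            (λ {i′} le → trans (high sc (n + i′)) (tab le)) L<n refl refl refl refl
          sc₂ = scratch-trans sc (scratch-weaken (m≤m+n 7 1) sc₁)
          m₂ , s₂ , rest = finish (holds-scratch sc₂ h) (λ {i′} le → trans (high sc₂ (n + i′)) (tab le))
            (low sc₁ 7) (trans ex₁ (accumulate-entry L))
      in m₂ , relax time
                (calc⟨ -‿value (Holds.size h) eL ⟩ jzero₂ (⊖-nonzero (>⇒≢ L<n)) ⨾
                 calc⟨ +-value (Holds.one h) eL ⟩ calc⟨ refl ⟩ calc⟨ refl ⟩ s₁ ⊕ s₂)
            , rest
      where
      finish : ∀ {m} → Holds p r m → Table L m → m 7 ≡ + suc L → m 8 ≡ entry (suc L) →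
        ∃[ m′ ] ((ISTORE , m) ⟶[ 3 ] (LLOOP , m′) × Holds p r m′ × Table (suc L) m′ ×
                 m′ 7 ≡ + suc L × m′ 8 ≡ entry (suc L))
      finish h tab eL ex =
        _ , (calc⟨ +-value (Holds.table h) eL ⟩ isStore at⟨ refl , entry-address L<n , ex ⟩ jump ⨾ done)
          , holds-entry (holds-scratch (scratch-≔ 12 _ scratch-refl) h)
          , table-entry tab , eL , ex
      arrange : ∀ t → 5 + (t + 3) ≡ 8 + t
      arrange = solve-∀
      time : 5 + (suc ⌊ suc L /2⌋ * (11 + T-time) + 3 + 3) ≤ 8 + I-time
      time = ≤-trans
        (+-monoʳ-≤ 5 (+-monoˡ-≤ 3 (+-monoˡ-≤ 3 (*-monoˡ-≤ (11 + T-time) (s≤s (≤-trans (⌊n/2⌋≤n (suc L)) L<n))))))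
        (≤-reflexive (arrange I-time))

    -- On entry, with `L = 0`, register 8 is still arbitrary; hence the guard `0 < L`. On exit it
    -- holds the entry that is compared with the rank.
    L-loop : ∀ D {r m L} → Holds p r m → Table L m → m 7 ≡ + L → (0 < L → m 8 ≡ entry L) → L + D ≡ n →
      ∃[ m′ ] ((LLOOP , m) ⟶[ D * (8 + I-time) + 2 ] (DECIDE , m′) × Holds p r m′ × Table n m′ ×
               (0 < n → m′ 8 ≡ entry n))
    L-loop zero {L = L} h tab eL ex eq with refl ← trans (sym (+-identityʳ L)) eq =
      _ , (calc⟨ -‿value (Holds.size h) eL ⟩ jzero₁ (⊖-zero {L} refl) ⨾ done)
        , holds-scratch (scratch-≔ 12 _ scratch-refl) h , tab , ex
    L-loop (suc D) {L = L} h tab eL ex eq =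
      let m₁ , s₁ , h₁ , tab₁ , eL₁ , ex₁ = L-step h tab eL (subst (L <_) eq (m<m+n L (s≤s z≤n)))
          m₂ , s₂ , rest = L-loop D h₁ tab₁ eL₁ (λ _ → ex₁) (trans (sym (+-suc L D)) eq)
      in m₂ , relax (≤-reflexive (sym (+-assoc (8 + I-time) (D * (8 + I-time)) 2))) (s₁ ⊕ s₂) , rest

    entry-count : ∀ {L} → 0 < L → entry L ≡ + countUnbordered c L
    entry-count {suc L} _ = refl

  -- The other entries belong to one prefix and are recomputed for the next; entry 0 is all that
  -- must survive between counts.
  Sentinel : Memory → Set
  Sentinel m = m (16 + (n + 0)) ≡ -1ℤ

  count : ∀ {p r m} → length p ≤ n → Holds p r m → Sentinel m →
    ∃[ m′ ] ((COUNT , m) ⟶[ suc L-time ] (DECIDE , m′) × Holds p r m′ × Sentinel m′ ×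
             m′ 8 ≡ + countUnbordered (prefix p) n)
  count {p} p≤n h sen =
    let m₁ , s₁ , h₁ , tab₁ , ex₁ = L-loop n (holds-scratch (scratch-≔ 7 _ scratch-refl) h) (λ { z≤n → sen }) refl (λ ()) refl
    in m₁ , (calc⟨ refl ⟩ s₁) , h₁ , tab₁ z≤n , trans (ex₁ 0<n) (entry-count 0<n)
    where open Loops p p≤n

  -- Search for the next letter

  length-∷ʳ : ∀ (p : Word K) a → length (p ∷ʳ a) ≡ suc (length p)
  length-∷ʳ p a = trans (length-++ p) (+-comm (length p) 1)

  prefix-∷ʳ⁻ : ∀ (p : Word K) {a t b} → prefix (p ∷ʳ a) t ≡ just b →
    (t < length p × prefix p t ≡ just b) ⊎ (t ≡ length p × a ≡ b)
  prefix-∷ʳ⁻ []      {t = zero}  refl = inj₂ (refl , refl)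
  prefix-∷ʳ⁻ (x ∷ p) {t = zero}  eq   = inj₁ (s≤s z≤n , eq)
  prefix-∷ʳ⁻ (x ∷ p) {t = suc t} eq with prefix-∷ʳ⁻ p eq
  ... | inj₁ (lt , eq′)   = inj₁ (s≤s lt , eq′)
  ... | inj₂ (refl , eq′) = inj₂ (refl , eq′)

  prefix-∷ʳ⁺ : ∀ (p : Word K) {a t b} → prefix p t ≡ just b → prefix (p ∷ʳ a) t ≡ just b
  prefix-∷ʳ⁺ (x ∷ p) {t = zero}  eq = eq
  prefix-∷ʳ⁺ (x ∷ p) {t = suc t} eq = prefix-∷ʳ⁺ p eq

  letter-∷ʳ : ∀ {p : Word K} {m} a → (∀ {t b} → prefix p t ≡ just b → m (16 + t) ≡ + suc (toℕ b)) →
    ∀ {t b} → prefix (p ∷ʳ a) t ≡ just b → (m [ 16 + length p ≔ + suc (toℕ a) ]) (16 + t) ≡ + suc (toℕ b)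
  letter-∷ʳ {p} {m} a letter {t} eq with prefix-∷ʳ⁻ p eq
  ... | inj₁ (lt , eq′)    = trans (≔-other m {16 + length p} {16 + t} _ (<⇒≢ (+-monoʳ-< 16 lt))) (letter eq′)
  ... | inj₂ (refl , refl) = ≔-same m (16 + length p) _

  sentinel-≔ : ∀ {m t x} → t < n → Sentinel m → Sentinel (m [ 16 + t ≔ x ])
  sentinel-≔ {m} {t} {x} t<n sen =
    trans (≔-other m {16 + t} {16 + (n + 0)} x (>⇒≢ (+-monoʳ-< 16 (<-≤-trans t<n (m≤m+n n 0))))) sen

  advance : ∀ {p ρ m} → length p < n → Holds p ρ m → Sentinel m →
    ∃[ m′ ] ((NEXT , m) ⟶[ 5 ] (COUNT , m′) × Holds (p ∷ʳ fzero) ρ m′ × Sentinel m′)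
  advance {p} {m = m} p<n h sen =
    _ , (calc⟨ -‿value size len ⟩ jzero₂ (⊖-nonzero (>⇒≢ p<n)) ⨾ calc⟨ +-value base len ⟩
         isStore at⟨ refl , address p<n , one ⟩ calc⟨ +-value one len ⟩ done)
      , record
        { rank = rank ; size = size ; letters = letters ; one = one ; base = base ; table = table
        ; len    = cong +_ (sym (length-∷ʳ p fzero))
        ; letter = letter-∷ʳ {p} {m₁} fzero letter
        }
      , sentinel-≔ {m₁} p<n sen
    where
    open Holds h
    m₁ = m [ 12 ≔ n ⊖ length p ] [ 12 ≔ + (16 + length p) ]

  reject : ∀ {p : Word K} {ρ C m} a a′ → toℕ a′ ≡ suc (toℕ a) → length p < n → C ≤ ρ →
    Holds (p ∷ʳ a) (suc ρ) m → Sentinel m → m 8 ≡ + C →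
    ∃[ m′ ] ((DECIDE , m) ⟶[ 9 ] (COUNT , m′) × Holds (p ∷ʳ a′) (suc (ρ ∸ C)) m′ × Sentinel m′)
  reject {p} {ρ} {C} {m} a a′ eq p<n C≤ρ h sen eC =
    _ , (calc⟨ -‿value eC rank ⟩ jneg₁ (⊖-negative (s≤s C≤ρ))
         ⨾ calc⟨ trans (-‿value rank eC) (trans (ℤ.⊖-≥ (m≤n⇒m≤1+n C≤ρ)) (cong +_ (+-∸-assoc 1 C≤ρ))) ⟩
         calc⟨ +-value base len′ ⟩ calc⟨ -‿value refl one ⟩
         isLoad from⟨ refl , address p<n , letter (prefix-last p) ⟩
         calc⟨ trans (+-value one refl) (cong (+_ ∘ suc) (sym eq)) ⟩
         isStore at⟨ refl , address p<n , refl ⟩ jump ⨾ done)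
      , record
        { rank = refl ; size = size ; letters = letters ; one = one ; base = base ; table = table
        ; len    = trans len′ (cong +_ (sym (length-∷ʳ p a′)))
        ; letter = letter-∷ʳ {p} {m₁} a′ (λ eq → letter (prefix-∷ʳ⁺ p eq))
        }
      , sentinel-≔ {m₁} p<n sen
    where
    open Holds h
    len′ = trans len (cong +_ (length-∷ʳ p a))
    m₁ = m [ 12 ≔ C ⊖ suc ρ ] [ 0 ≔ + suc (ρ ∸ C) ] [ 12 ≔ + (16 + suc (length p)) ] [ 12 ≔ + (16 + length p) ]
           [ 13 ≔ + suc (toℕ a) ] [ 13 ≔ + suc (toℕ a′) ]
    prefix-last : ∀ (p : Word K) {a} → prefix (p ∷ʳ a) (length p) ≡ just a
    prefix-last []      = refl
    prefix-last (x ∷ p) = prefix-last p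

  -- Three instructions suffice; the bound is that of `reject`, so that every trial costs
  -- `try-time`.
  accept : ∀ {p ρ C m} → suc ρ ≤ C → Holds p (suc ρ) m → m 8 ≡ + C →
    ∃[ m′ ] ((DECIDE , m) ⟶[ 9 ] (NEXT , m′) × Scratch 7 m m′)
  accept ρ<C h eC =
    _ , (calc⟨ -‿value eC (Holds.rank h) ⟩ jneg₂ (⊖-nonnegative ρ<C) ⨾ jump ⨾ done)
      , scratch-≔ 12 _ scratch-refl

  count-extending : ∀ {p l r m} a → suc (length p) + l ≡ n → Holds (p ∷ʳ a) r m → Sentinel m →
    ∃[ m′ ] ((COUNT , m) ⟶[ suc L-time ] (DECIDE , m′) × Holds (p ∷ʳ a) r m′ × Sentinel m′ ×
             m′ 8 ≡ + length (extending (p ∷ʳ a) l))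
  count-extending {p} {l} a eq h sen =
    let m₁ , s₁ , h₁ , sen₁ , eC = count (m+n≤o⇒m≤o (length (p ∷ʳ a)) (≤-reflexive len)) h sen
    in m₁ , s₁ , h₁ , sen₁ , trans eC (cong +_ (sym C≡))
    where
    len : length (p ∷ʳ a) + l ≡ n
    len = trans (cong (_+ l) (length-∷ʳ p a)) eq
    C≡ : length (extending (p ∷ʳ a) l) ≡ countUnbordered (prefix (p ∷ʳ a)) n
    C≡ = trans (length-extending-count (p ∷ʳ a) l) (cong (countUnbordered (prefix (p ∷ʳ a))) len)

  -- Induction on the number of letters left. They are required to be consecutive because the
  -- program passes from one to the next by adding 1 to the stored letter.
  choose : ∀ j (f : Fin (suc j) → Fin K) {p l w a₀ ρ m} → (∀ i → toℕ (f i) ≡ a₀ + toℕ i) →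
    suc (length p) + l ≡ n → Holds (p ∷ʳ f fzero) (suc ρ) m → Sentinel m →
    (extending (p ∷ʳ f fzero) l ++ extendingBy p (f ∘ fsuc) l) [ ρ ]= w →
    ∃[ m′ ] ∃[ a ] ∃[ ρ′ ] ((COUNT , m) ⟶[ suc j * try-time ] (NEXT , m′) ×
      Holds (p ∷ʳ a) (suc ρ′) m′ × Sentinel m′ × extending (p ∷ʳ a) l [ ρ′ ]= w)
  choose j f {p} {l} {w} {a₀} {ρ} consecutive eq h sen ix
    with ρ <? length (extending (p ∷ʳ f fzero) l)
  choose j f {p} {l} {w} {a₀} {ρ} consecutive eq h sen ix | yes ρ<C =
    let m₁ , s₁ , h₁ , sen₁ , eC = count-extending (f fzero) eq h sen
        m₂ , s₂ , sc₂ = accept ρ<C h₁ eC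
    in m₂ , f fzero , ρ , relax (m≤m+n try-time (j * try-time)) (s₁ ⊕ s₂)
          , holds-scratch sc₂ h₁ , trans (high sc₂ (n + 0)) sen₁ , []=-++ˡ (extending (p ∷ʳ f fzero) l) ix ρ<C
  -- After the last letter the rest of the listing is empty and cannot contain `w`.
  choose zero f {p} {l} consecutive eq h sen ix | no ρ≮C
    with () ← []=-++ʳ (extending (p ∷ʳ f fzero) l) ix (≮⇒≥ ρ≮C)
  choose (suc j) f {p} {l} {w} {a₀} {ρ} consecutive eq h sen ix | no ρ≮C =
    let m₁ , s₁ , h₁ , sen₁ , eC = count-extending (f fzero) eq h sen
        m₂ , s₂ , h₂ , sen₂ = reject {p} (f fzero) (f (fsuc fzero)) succ
                                (m+n≤o⇒m≤o (suc (length p)) (≤-reflexive eq)) (≮⇒≥ ρ≮C) h₁ sen₁ eC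
        m₃ , a , ρ′ , s₃ , rest = choose j (f ∘ fsuc) {p} (λ i → trans (consecutive (fsuc i)) (+-suc a₀ (toℕ i)))
                                    eq h₂ sen₂ (subst (_[ ρ ∸ length (extending (p ∷ʳ f fzero) l) ]= w) (extendingBy-suc p (f ∘ fsuc) l)
                                      ([]=-++ʳ (extending (p ∷ʳ f fzero) l) ix (≮⇒≥ ρ≮C)))
    in m₃ , a , ρ′ , ((s₁ ⊕ s₂) ⊕ s₃) , rest
    where
    succ : toℕ (f (fsuc fzero)) ≡ suc (toℕ (f fzero))
    succ = trans (consecutive (fsuc fzero)) (trans (+-suc a₀ 0) (cong suc (sym (consecutive fzero))))

  -- The invariant is that `w` has rank `suc ρ` among the unbordered words that begin with `p`. For
  -- `l = 0` that list contains at most `p`, so `w` is `p`.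
  spell : ∀ l {p w ρ m} → length p + l ≡ n → Holds p (suc ρ) m → Sentinel m → extending p l [ ρ ]= w →
    ∃[ m′ ] ∃[ r ] ((NEXT , m) ⟶[ l * (5 + K * try-time) + 2 ] (END , m′) × Holds w r m′)
  spell zero {p} {w} {ρ} {m} eq h sen ix =
    _ , suc ρ , (calc⟨ -‿value (Holds.size h) (Holds.len h) ⟩
                 jzero₁ (⊖-zero {n} {length p} (trans (sym eq) (+-identityʳ _))) ⨾ done)
      , subst (λ x → Holds x (suc ρ) (m [ 12 ≔ n ⊖ length p ]))
          (sym (trans (filter-[x]-[]= unbordered? ix) (++-identityʳ p)))
          (holds-scratch (scratch-≔ 12 _ scratch-refl) h)
  spell (suc l) {p} {w} {ρ} eq h sen ix =
    let m₁ , s₁ , h₁ , sen₁ = advance (subst (length p <_) eq (m<m+n (length p) (s≤s z≤n))) h sen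
        m₂ , a , ρ₂ , s₂ , h₂ , sen₂ , ix₂ = choose κ id {p} {l} {w} (λ _ → refl) (trans (sym (+-suc (length p) l)) eq) h₁ sen₁
          (subst (_[ ρ ]= w) (extendingBy-suc p id l) ix)
        m₃ , r , s₃ , h₃ = spell l {p ∷ʳ a} (trans (cong (_+ l) (length-∷ʳ p a)) (trans (sym (+-suc (length p) l)) eq)) h₂ sen₂ ix₂
    in m₃ , r , relax (≤-reflexive (sym (+-assoc (5 + K * try-time) (l * (5 + K * try-time)) 2))) ((s₁ ⊕ s₂) ⊕ s₃) , h₃

  -- 5 instructions of initialisation and the final `move`; `halt` is added by `⟶⇒Run`.
  time : ℕ
  time = 5 + (n * (5 + K * try-time) + 2 + 1)

  unrank : ∀ {w ρ} → unborderedWords K n [ ρ ]= w →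
    ∃[ m ] ((0 , input (suc ρ) n K) ⟶[ time ] (61 , m) × Outputs m w)
  unrank {w} {ρ} ix =
    let m₁ , r , s₁ , h₁ = spell n {[]} refl h₀ sen₀ (subst (_[ ρ ]= w) (unborderedWords≡extending n) ix)
    in _ , (calc⟨ refl ⟩ calc⟨ refl ⟩ calc⟨ refl ⟩ calc⟨ refl ⟩
            isStore at⟨ refl , s≤s (+-monoʳ-≤ 16 (m≤m+n n n)) , refl ⟩ s₁ ⊕ (calc⟨ Holds.base h₁ ⟩ done))
         , 16 , refl , λ i → Holds.letter h₁ (prefix-lookup w i)
    where
    m₀ = input (suc ρ) n K [ 3 ≔ 1ℤ ] [ 5 ≔ + 16 ] [ 6 ≔ + (16 + n) ] [ 12 ≔ -1ℤ ]
    h₀ : Holds [] (suc ρ) (m₀ [ 16 + n ≔ -1ℤ ])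
    h₀ = record { rank = refl ; size = refl ; letters = refl ; one = refl ; len = refl
                ; base = refl ; table = refl ; letter = λ () }
    sen₀ : Sentinel (m₀ [ 16 + n ≔ -1ℤ ])
    sen₀ = trans (cong (λ x → (m₀ [ 16 + n ≔ -1ℤ ]) (16 + x)) (+-identityʳ n)) (≔-same m₀ (16 + n) -1ℤ)
    prefix-lookup : ∀ (w : Word K) i → prefix w (toℕ i) ≡ just (lookup w i)
    prefix-lookup (a ∷ w) fzero    = refl
    prefix-lookup (a ∷ w) (fsuc i) = prefix-lookup w i

  computes : ∀ {w ρ} → unborderedWords K n [ ρ ]= w → Computes program (input (suc ρ) n K) w (suc time) (17 + (n + n))
  computes ix =
    let m , s , out = unrank ix
        t , as , run , t≤ , bnd = ⟶⇒Run s refl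
    in t , as , m , run , out , t≤ , space-bounded as bnd

-- The left-hand side is suc (Unranking.time n (k ∸ 1) _), unfolded.
time-polynomial : ∀ n k →
  suc (5 + (n * (5 + k * (1 + (n * (8 + (suc n * (11 + (n * 16 + 2)) + 3)) + 2 + 9))) + 2 + 1)) ≡
  16 * (n * n * n * n * k) + 29 * (n * n * n * k) + 24 * (n * n * k) + 12 * (n * k) + 5 * n + 9
time-polynomial = solve-∀

-- Every monomial of the exact polynomial is at most n⁴k because n and k are positive, and 95 = 16 +
-- 29 + 24 + 12 + 5 + 9 is the sum of the coefficients.
time-bounded : ∀ n κ (0<n : 0 < n) → suc (Unranking.time n κ 0<n) ≤ 95 * (n ^ 4 * suc κ)
time-bounded n@(suc _) κ 0<n = ≤-trans (≤-reflexive (time-polynomial n K)) (≤-trans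
  (+-mono-≤ (+-mono-≤ (+-mono-≤ (+-mono-≤ (+-monoʳ-≤ (16 * n⁴K)
    (*-monoʳ-≤ 29 d₃)) (*-monoʳ-≤ 24 d₂)) (*-monoʳ-≤ 12 d₁)) (*-monoʳ-≤ 5 d₀)) (*-monoʳ-≤ 9 1≤n⁴K))
  (≤-reflexive (trans (collect n⁴K) (cong (λ x → 95 * (x * K)) (power n)))))
  where
  K = suc κ
  n⁴K = n * n * n * n * K
  d₃ : n * n * n * K ≤ n⁴K
  d₃ = *-monoˡ-≤ K (m≤m*n (n * n * n) n)
  d₂ : n * n * K ≤ n⁴K
  d₂ = ≤-trans (*-monoˡ-≤ K (m≤m*n (n * n) n)) d₃
  d₁ : n * K ≤ n⁴K
  d₁ = ≤-trans (*-monoˡ-≤ K (m≤m*n n n)) d₂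
  d₀ : n ≤ n⁴K
  d₀ = ≤-trans (m≤m*n n K) d₁
  1≤n⁴K : 1 ≤ n⁴K
  1≤n⁴K = ≤-trans 0<n d₀
  collect : ∀ x → 16 * x + 29 * x + 24 * x + 12 * x + 5 * x + 9 * x ≡ 95 * x
  collect = solve-∀
  power : ∀ n → n * n * n * n ≡ n * (n * (n * (n * 1)))
  power = solve-∀

space-bounded-linear : ∀ n → 0 < n → 17 + (n + n) ≤ 19 * n
space-bounded-linear n 0<n =
  ≤-trans (+-monoˡ-≤ (n + n) (*-monoʳ-≤ 17 0<n)) (≤-reflexive (collect n))
  where
  collect : ∀ n → 17 * n + (n + n) ≡ 19 * n
  collect = solve-∀

computes-mono : ∀ {k P m} {w : Word k} {T T′ S S′} → T ≤ T′ → S ≤ S′ → Computes P m w T S → Computes P m w T′ S′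
computes-mono T≤ S≤ (t , as , m , run , out , t≤ , s≤) = t , as , m , run , out , ≤-trans t≤ T≤ , ≤-trans s≤ S≤

lookup-[]= : ∀ {A : Set} (xs : List A) i → xs [ toℕ i ]= lookup xs i
lookup-[]= (x ∷ xs) fzero    = here
lookup-[]= (x ∷ xs) (fsuc i) = there (lookup-[]= xs i)

theorem12 : Σ[ P ∈ Program ] Σ[ C₁ ∈ ℕ ] Σ[ C₂ ∈ ℕ ]
    (∀ (n k r : ℕ) → 1 ≤ n → 2 ≤ k → 1 ≤ r → r ≤ length (unborderedWords k n) →
    Σ[ w ∈ Word k ] (HasRank n w r ×
    Computes P (input r n k) w (C₁ * (n ^ 4 * k * ⌊log₂ k ⌋)) (C₂ * n)))
theorem12 = program , 95 , 19 , unranks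
  where
  unranks : ∀ (n k r : ℕ) → 1 ≤ n → 2 ≤ k → 1 ≤ r → r ≤ length (unborderedWords k n) →
    Σ[ w ∈ Word k ] (HasRank n w r × Computes program (input r n k) w (95 * (n ^ 4 * k * ⌊log₂ k ⌋)) (19 * n))
  unranks n k@(suc κ) (suc ρ) 1≤n 2≤k _ ρ< =
    lookup U i , (i , cong suc (toℕ-fromℕ< ρ<) , refl) ,
    computes-mono {w = lookup U i} (≤-trans (time-bounded n κ 1≤n) (*-monoʳ-≤ 95 log-factor)) (space-bounded-linear n 1≤n)
      (Unranking.computes n κ 1≤n (subst (U [_]= lookup U i) (toℕ-fromℕ< ρ<) (lookup-[]= U i)))
    where
    U = unborderedWords k n
    i = fromℕ< ρ<
    -- From k ≥ 2 the logarithm is at least 1.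
    log-factor : n ^ 4 * k ≤ n ^ 4 * k * ⌊log₂ k ⌋
    log-factor = subst (_≤ n ^ 4 * k * ⌊log₂ k ⌋) (*-identityʳ (n ^ 4 * k))
      (*-monoʳ-≤ (n ^ 4 * k) (subst (_≤ ⌊log₂ k ⌋) (⌊log₂[2^n]⌋≡n 1) (⌊log₂⌋-mono-≤ 2≤k)))
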